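{- There is an absolute constant $C$ such that for every integer $n \ge 1$, $$D(n) \ge \left(\frac12 + \frac1{257}\right) n - C.$$
   Context: Let $P$ be a finite set of points in the plane. A disk (of positive radius) is empty (with respect to $P$) if its interior contains no point of $P$. Disks are called pairwise-disjoint if their interiors are pairwise disjoint (so two disks may touch at a common boundary point). $D(P)$ is the minimum number of disks in a family of pairwise-disjoint empty disks such that each point of $P$ lies on the boundary of at least one disk of the family. $D(n)$ is the maximum of $D(P)$ over all sets $P$ of $n$ points in the plane. -}

module Defs where

open import Data.Fin.Base using (Fin)
open import Data.Integer.Base using (+_)
open import Data.Nat.Base as ℕ using (ℕ; _⊔_)
import Data.Nat.Properties as ℕₚ
open import Data.Product.Base using (_×_; _,_; ∃)
open import Data.Rational.Base as ℚ using (ℚ; 0ℚ; 1ℚ; ½; ∣_∣; Positive)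
import Data.Rational.Properties as ℚₚ
open import Data.Rational.Solver using (module +-*-Solver)
open import Function.Definitions using (Injective)
open import Relation.Binary.PropositionalEquality
  using (_≡_; _≢_; refl; sym; trans; cong; subst)
open import Relation.Nullary.Negation.Core using (¬_)

------------------------------------------------------------------------
-- The reals as Cauchy sequences of rationals

IsCauchy : (ℕ → ℚ) → Set
IsCauchy s = ∀ ε → 0ℚ ℚ.< ε →
  ∃ λ N → ∀ m n → N ℕ.≤ m → N ℕ.≤ n → ∣ s m ℚ.- s n ∣ ℚ.< ε

record ℝ : Set where
  constructor mkℝ
  field
    seq    : ℕ → ℚ
    cauchy : IsCauchy seq

open ℝ public

private
  half-pos : ∀ {ε} → 0ℚ ℚ.< ε → 0ℚ ℚ.< ½ ℚ.* ε
  half-pos {ε} 0<ε =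
    ℚₚ.positive⁻¹ (½ ℚ.* ε) {{ℚₚ.pos*pos⇒pos ½ ε {{ℚ.positive 0<ε}}}}

  half+half : ∀ ε → ½ ℚ.* ε ℚ.+ ½ ℚ.* ε ≡ ε
  half+half ε = trans (sym (ℚₚ.*-distribʳ-+ ε ½ ½)) (ℚₚ.*-identityˡ ε)

  diff-+ : ∀ a b c d → (a ℚ.+ b) ℚ.- (c ℚ.+ d) ≡ (a ℚ.- c) ℚ.+ (b ℚ.- d)
  diff-+ = solve 4 (λ a b c d → (a :+ b) :- (c :+ d) := (a :- c) :+ (b :- d)) refl
    where open +-*-Solver

  diff-neg : ∀ a c → (ℚ.- a) ℚ.- (ℚ.- c) ≡ ℚ.- (a ℚ.- c)
  diff-neg = solve 2 (λ a c → (:- a) :- (:- c) := :- (a :- c)) refl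
    where open +-*-Solver

  diff-* : ∀ a b c d → a ℚ.* b ℚ.- c ℚ.* d ≡ a ℚ.* (b ℚ.- d) ℚ.+ d ℚ.* (a ℚ.- c)
  diff-* = solve 4 (λ a b c d → a :* b :- c :* d := a :* (b :- d) :+ d :* (a :- c)) refl
    where open +-*-Solver

  split : ∀ a b → a ≡ (a ℚ.- b) ℚ.+ b
  split = solve 2 (λ a b → a := (a :- b) :+ b) refl
    where open +-*-Solver

  EventuallyBoundedBy : (ℕ → ℚ) → ℚ → Set
  EventuallyBoundedBy s B = ∃ λ N → ∀ n → N ℕ.≤ n → ∣ s n ∣ ℚ.≤ B

  bounded : ∀ {s} → IsCauchy s → ∃ λ B → Positive B × EventuallyBoundedBy s B
  bounded {s} cs with cs 1ℚ (ℚₚ.positive⁻¹ 1ℚ)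
  ... | N , h = 1ℚ ℚ.+ ∣ s N ∣ , pos , N , bound
    where
    open ℚₚ.≤-Reasoning
    pos : Positive (1ℚ ℚ.+ ∣ s N ∣)
    pos = ℚₚ.pos+nonNeg⇒pos 1ℚ ∣ s N ∣ {{ℚ.nonNegative (ℚₚ.0≤∣p∣ (s N))}}
    bound : ∀ n → N ℕ.≤ n → ∣ s n ∣ ℚ.≤ 1ℚ ℚ.+ ∣ s N ∣
    bound n N≤n = begin
      ∣ s n ∣                          ≡⟨ cong ∣_∣ (split (s n) (s N)) ⟩
      ∣ (s n ℚ.- s N) ℚ.+ s N ∣        ≤⟨ ℚₚ.∣p+q∣≤∣p∣+∣q∣ (s n ℚ.- s N) (s N) ⟩
      ∣ s n ℚ.- s N ∣ ℚ.+ ∣ s N ∣      ≤⟨ ℚₚ.+-monoˡ-≤ ∣ s N ∣ (ℚₚ.<⇒≤ (h n N N≤n ℕₚ.≤-refl)) ⟩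
      1ℚ ℚ.+ ∣ s N ∣                   ∎

  scaled : ∀ B → Positive B → ∀ ε → 0ℚ ℚ.< ε →
           ∃ λ δ → 0ℚ ℚ.< δ × B ℚ.* δ ≡ ε
  scaled B B>0 ε 0<ε = δ , ℚₚ.positive⁻¹ δ {{δ>0}} , eq
    where
    instance
      _ = B>0
      _ = ℚₚ.pos⇒nonZero B
      _ = ℚₚ.1/pos⇒pos B
      _ = ℚ.positive 0<ε
    δ = (ℚ.1/ B) ℚ.* ε
    δ>0 : Positive δ
    δ>0 = ℚₚ.pos*pos⇒pos (ℚ.1/ B) ε
    eq : B ℚ.* δ ≡ ε
    eq = trans (sym (ℚₚ.*-assoc B (ℚ.1/ B) ε))
           (trans (cong (ℚ._* ε) (ℚₚ.*-inverseʳ B)) (ℚₚ.*-identityˡ ε))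

  ∣*∣<  : ∀ {A δ ε} x y → Positive A → A ℚ.* δ ≡ ε →
          ∣ x ∣ ℚ.≤ A → ∣ y ∣ ℚ.< δ → ∣ x ℚ.* y ∣ ℚ.< ε
  ∣*∣< {A} {δ} {ε} x y A>0 eq x≤A y<δ = begin-strict
    ∣ x ℚ.* y ∣        ≡⟨ ℚₚ.∣p*q∣≡∣p∣*∣q∣ x y ⟩
    ∣ x ∣ ℚ.* ∣ y ∣    ≤⟨ ℚₚ.*-monoʳ-≤-nonNeg ∣ y ∣ {{ℚ.nonNegative (ℚₚ.0≤∣p∣ y)}} x≤A ⟩
    A ℚ.* ∣ y ∣        <⟨ ℚₚ.*-monoʳ-<-pos A {{A>0}} y<δ ⟩
    A ℚ.* δ            ≡⟨ eq ⟩
    ε                  ∎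
    where open ℚₚ.≤-Reasoning

  ∣+∣< : ∀ {ε} x y → ∣ x ∣ ℚ.< ½ ℚ.* ε → ∣ y ∣ ℚ.< ½ ℚ.* ε → ∣ x ℚ.+ y ∣ ℚ.< ε
  ∣+∣< {ε} x y hx hy = begin-strict
    ∣ x ℚ.+ y ∣              ≤⟨ ℚₚ.∣p+q∣≤∣p∣+∣q∣ x y ⟩
    ∣ x ∣ ℚ.+ ∣ y ∣          <⟨ ℚₚ.+-mono-< hx hy ⟩
    ½ ℚ.* ε ℚ.+ ½ ℚ.* ε      ≡⟨ half+half ε ⟩
    ε                        ∎
    where open ℚₚ.≤-Reasoning

  *-close : ∀ {s t : ℕ → ℚ} {ε A B δ η K L M N} →
    Positive A → Positive B → A ℚ.* δ ≡ ½ ℚ.* ε → B ℚ.* η ≡ ½ ℚ.* ε →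
    (∀ n → K ℕ.≤ n → ∣ s n ∣ ℚ.≤ A) →
    (∀ n → L ℕ.≤ n → ∣ t n ∣ ℚ.≤ B) →
    (∀ m n → M ℕ.≤ m → M ℕ.≤ n → ∣ t m ℚ.- t n ∣ ℚ.< δ) →
    (∀ m n → N ℕ.≤ m → N ℕ.≤ n → ∣ s m ℚ.- s n ∣ ℚ.< η) →
    ∃ λ J → ∀ m n → J ℕ.≤ m → J ℕ.≤ n →
      ∣ s m ℚ.* t m ℚ.- s n ℚ.* t n ∣ ℚ.< ε
  *-close {s} {t} {ε} {K = K} {L} {M} {N} A>0 B>0 Aδ Bη s≤A t≤B ht hs =
    (K ⊔ L) ⊔ (M ⊔ N) , λ m n hm hn →
      let
        KL≤m = ℕₚ.m⊔n≤o⇒m≤o (K ⊔ L) (M ⊔ N) hm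
        MN≤m = ℕₚ.m⊔n≤o⇒n≤o (K ⊔ L) (M ⊔ N) hm
        KL≤n = ℕₚ.m⊔n≤o⇒m≤o (K ⊔ L) (M ⊔ N) hn
        MN≤n = ℕₚ.m⊔n≤o⇒n≤o (K ⊔ L) (M ⊔ N) hn
      in
      subst (λ z → ∣ z ∣ ℚ.< ε) (sym (diff-* (s m) (t m) (s n) (t n)))
        (∣+∣< (s m ℚ.* (t m ℚ.- t n)) (t n ℚ.* (s m ℚ.- s n))
          (∣*∣< (s m) (t m ℚ.- t n) A>0 Aδ
            (s≤A m (ℕₚ.m⊔n≤o⇒m≤o K L KL≤m))
            (ht m n (ℕₚ.m⊔n≤o⇒m≤o M N MN≤m) (ℕₚ.m⊔n≤o⇒m≤o M N MN≤n)))
          (∣*∣< (t n) (s m ℚ.- s n) B>0 Bη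
            (t≤B n (ℕₚ.m⊔n≤o⇒n≤o K L KL≤n))
            (hs m n (ℕₚ.m⊔n≤o⇒n≤o M N MN≤m) (ℕₚ.m⊔n≤o⇒n≤o M N MN≤n))))

abstract
  const-cauchy : ∀ q → IsCauchy (λ _ → q)
  const-cauchy q ε 0<ε =
    0 , λ _ _ _ _ → subst (ℚ._< ε) (sym (cong ∣_∣ (ℚₚ.+-inverseʳ q))) 0<ε

  +-cauchy : ∀ s t → IsCauchy s → IsCauchy t → IsCauchy (λ n → s n ℚ.+ t n)
  +-cauchy s t cs ct ε 0<ε
    with M , hs ← cs (½ ℚ.* ε) (half-pos 0<ε)
       | N , ht ← ct (½ ℚ.* ε) (half-pos 0<ε)
    = M ⊔ N , λ m n hm hn →
      subst (λ z → ∣ z ∣ ℚ.< ε) (sym (diff-+ (s m) (t m) (s n) (t n)))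
        (∣+∣< (s m ℚ.- s n) (t m ℚ.- t n)
          (hs m n (ℕₚ.m⊔n≤o⇒m≤o M N hm) (ℕₚ.m⊔n≤o⇒m≤o M N hn))
          (ht m n (ℕₚ.m⊔n≤o⇒n≤o M N hm) (ℕₚ.m⊔n≤o⇒n≤o M N hn)))

  neg-cauchy : ∀ s → IsCauchy s → IsCauchy (λ n → ℚ.- s n)
  neg-cauchy s cs ε 0<ε with N , h ← cs ε 0<ε =
    N , λ m n hm hn →
      subst (ℚ._< ε)
        (sym (trans (cong ∣_∣ (diff-neg (s m) (s n))) (ℚₚ.∣-p∣≡∣p∣ (s m ℚ.- s n))))
        (h m n hm hn)

  *-cauchy : ∀ s t → IsCauchy s → IsCauchy t → IsCauchy (λ n → s n ℚ.* t n)
  *-cauchy s t cs ct ε 0<ε =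
    let
      A , A>0 , K , s≤A = bounded cs
      B , B>0 , L , t≤B = bounded ct
      δ , 0<δ , Aδ = scaled A A>0 (½ ℚ.* ε) (half-pos 0<ε)
      η , 0<η , Bη = scaled B B>0 (½ ℚ.* ε) (half-pos 0<ε)
      M , ht = ct δ 0<δ
      N , hs = cs η 0<η
    in
    *-close {s} {t} {ε} A>0 B>0 Aδ Bη s≤A t≤B ht hs

infixl 7 _*_
infixl 6 _+_ _-_
infix  8 -_
infix  4 _<_ _≈_

fromℚ : ℚ → ℝ
fromℚ q = mkℝ (λ _ → q) (const-cauchy q)

0ℝ : ℝ
0ℝ = fromℚ 0ℚ

_+_ : ℝ → ℝ → ℝ
x + y = mkℝ (λ n → seq x n ℚ.+ seq y n) (+-cauchy (seq x) (seq y) (cauchy x) (cauchy y))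

-_ : ℝ → ℝ
- x = mkℝ (λ n → ℚ.- seq x n) (neg-cauchy (seq x) (cauchy x))

_-_ : ℝ → ℝ → ℝ
x - y = x + (- y)

_*_ : ℝ → ℝ → ℝ
x * y = mkℝ (λ n → seq x n ℚ.* seq y n) (*-cauchy (seq x) (seq y) (cauchy x) (cauchy y))

-- Distinct sequences can represent the same real, so equality of reals is
-- _≈_, never _≡_.
_≈_ : ℝ → ℝ → Set
x ≈ y = ∀ ε → 0ℚ ℚ.< ε →
  ∃ λ N → ∀ n → N ℕ.≤ n → ∣ seq x n ℚ.- seq y n ∣ ℚ.< ε

-- Termwise strict inequality is not enough: the eventual gap must stay away
-- from 0.
_<_ : ℝ → ℝ → Set
x < y = ∃ λ ε → 0ℚ ℚ.< ε ×
  (∃ λ N → ∀ n → N ℕ.≤ n → seq x n ℚ.+ ε ℚ.< seq y n)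

------------------------------------------------------------------------
-- Points and disks in the plane

Point : Set
Point = ℝ × ℝ

infix 4 _≈ₚ_

_≈ₚ_ : Point → Point → Set
(x₁ , y₁) ≈ₚ (x₂ , y₂) = x₁ ≈ x₂ × y₁ ≈ y₂

dist² : Point → Point → ℝ
dist² (x₁ , y₁) (x₂ , y₂) = (x₁ - x₂) * (x₁ - x₂) + (y₁ - y₂) * (y₁ - y₂)

record Disk : Set where
  field
    centre   : Point
    radius   : ℝ
    radius>0 : 0ℝ < radius

open Disk public

-- As radii are positive, distances to the centre can be compared with the
-- radius through their squares.
InInterior : Point → Disk → Set
InInterior p D = dist² p (centre D) < radius D * radius D

OnBoundary : Point → Disk → Set
OnBoundary p D = dist² p (centre D) ≈ radius D * radius D

InteriorsDisjoint : Disk → Disk → Set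
InteriorsDisjoint D E = ∀ p → ¬ (InInterior p D × InInterior p E)

------------------------------------------------------------------------
-- Point sets and families of disks

record PointSet (n : ℕ) : Set where
  field
    point    : Fin n → Point
    distinct : Injective _≡_ _≈ₚ_ point

open PointSet public

Empty : ∀ {n} → PointSet n → Disk → Set
Empty P D = ∀ i → ¬ InInterior (point P i) D

record DisjointEmptyCover {n : ℕ} (P : PointSet n) (k : ℕ) : Set where
  field
    disk     : Fin k → Disk
    disjoint : ∀ i j → i ≢ j → InteriorsDisjoint (disk i) (disk j)
    empty    : ∀ i → Empty P (disk i)
    covers   : ∀ i → ∃ λ j → OnBoundary (point P i) (disk j)

------------------------------------------------------------------------
-- The numbers D(P) and D(n), given by their graphs

IsMinimum : (ℕ → Set) → ℕ → Set
IsMinimum Q k = Q k × (∀ m → Q m → k ℕ.≤ m)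

IsMaximum : (ℕ → Set) → ℕ → Set
IsMaximum Q k = Q k × (∀ m → Q m → m ℕ.≤ k)

infix 4 D[_]≡_ Dmax[_]≡_

D[_]≡_ : ∀ {n} → PointSet n → ℕ → Set
D[ P ]≡ k = IsMinimum (DisjointEmptyCover P) k

Dmax[_]≡_ : ℕ → ℕ → Set
Dmax[ n ]≡ d = IsMaximum (λ k → ∃ λ (P : PointSet n) → D[ P ]≡ k) d

fromℕ : ℕ → ℚ
fromℕ n = + n ℚ./ 1

{-# OPTIONS --safe #-}

-- The points lie in a strip between two walls.  A wall is a long row of rungs,
-- pairs of points that are very close compared with the distance of consecutive
-- rungs, and hubs are placed sparsely on the line midway between the walls, one
-- for every 28 columns.  A disk cannot touch two hubs.  A disk touching a hub or
-- the opposite wall (an inner disk) is so large that near a wall it is almost a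
-- half-plane, and it touches at most one point of each rung.  Any other disk
-- touches points of at most two rungs of a wall, which are consecutive; two
-- disjoint disks touching the two points of a rung are separated there nearly
-- along its perpendicular bisector, and the slopes of these bisectors vary
-- periodically, so that savings do not propagate along the wall.  Hence the
-- rungs can be charged injectively with disks that touch no hub, and the number
-- of disks is at least the number of rungs and hubs, up to a constant:  113
-- points (28 columns of two rungs, and a hub) require 57 disks, and
-- 57 / 113 ≥ 1 / 2 + 1 / 257.
--
-- The power function d (x² + y²) + a x + b y + c of a disk is linear in its
-- coefficients, and the conditions on the disk are linear inequalities in them.
-- So each local fact about the walls is the infeasibility of a linear system,
-- certified by a nonnegative combination of at most four of its rows.
module Submission where

open import Defs using (Dmax[_]≡_; fromℕ)
import Defs as D
open import Data.Bool.Base using (Bool; true; false; _∧_; T)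
import Data.Bool.Properties as Boolₚ
open import Data.Bool.ListAction using (any)
open import Data.Empty using (⊥; ⊥-elim)
open import Data.Fin.Base using (Fin; toℕ; splitAt; join; remQuot; combine; _↑ˡ_)
open import Data.Fin.Patterns
import Data.Fin.Properties as Finₚ
open import Data.Integer.Base as ℤ using (ℤ; +_; -[1+_]; 0ℤ)
import Data.Integer.Properties as ℤₚ
import Data.Integer.Tactic.RingSolver as ℤR
open import Data.List.Base using (List; []; _∷_; map; _++_)
open import Data.List.Membership.Propositional using (find)
open import Data.List.Relation.Unary.All as All using (All; []; _∷_)
open import Data.List.Relation.Unary.All.Properties using (++⁺; map⁺)
open import Data.List.Relation.Unary.Any.Properties using (any⁻)
open import Data.Nat.Base as ℕ using (ℕ; zero; suc; z≤n; s≤s)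
open import Data.Nat.DivMod using (_mod_; m<n⇒m%n≡m; m≡m%n+[m/n]*n; m%n<n)
open import Data.Nat.Induction using (<-rec)
import Data.Nat.Properties as ℕₚ
import Data.Nat.Solver as ℕS
open import Data.Product.Base using (_×_; _,_; proj₁; proj₂; ∃; uncurry)
open import Data.Rational.Base as ℚ using (ℚ; ½)
open import Data.Rational.Literals using (fromℤ)
import Data.Rational.Properties as ℚₚ
import Data.Rational.Solver as ℚS
import Data.Rational.Unnormalised.Base as ℚᵘ
import Data.Rational.Unnormalised.Properties as ℚᵘₚ
open import Data.Sum.Base using (_⊎_; inj₁; inj₂; [_,_]′)
open import Data.Unit.Base using (tt)
open import Data.Vec.Base using (Vec; []; _∷_; lookup)
open import Function.Base using (_∘_; case_of_)
open import Function.Bundles using (Equivalence)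
open import Function.Definitions using (Injective)
open import Relation.Binary.Definitions using (tri<; tri≈; tri>)
open import Relation.Binary.PropositionalEquality
open import Relation.Nullary using (¬_; Dec; yes; no)
open import Relation.Nullary.Decidable
  using (⌊_⌋; toWitness; decidable-stable; ¬?; _⊎-dec_; _×-dec_; _→-dec_)

-- Linear inequalities for disks and their refutation

module Forms where

  open import Data.Integer.Base using (_+_; _-_; _*_; -_; _≤_; _<_; ∣_∣)

  -- d (x² + y²) + a x + b y + c with positive d, which is negative on an open disk.
  record Form : Set where
    constructor form
    field
      scale x-coeff y-coeff const : ℤ
      scale>0 : 0ℤ < scale
  open Form

  Row : Set
  Row = ℤ × ℤ × ℤ × ℤ

  infix 7 _∙_
  _∙_ : Row → Form → ℤ
  (e , x , y , w) ∙ f = e * scale f + x * x-coeff f + y * y-coeff f + w * const f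

  infix 4 _⊨_
  _⊨_ : Form → Row → Set
  f ⊨ r = 0ℤ ≤ r ∙ f

  Weighted : Set
  Weighted = List (ℕ × Row)

  total : Weighted → Row
  total [] = 0ℤ , 0ℤ , 0ℤ , 0ℤ
  total ((n , e , x , y , w) ∷ rs) =
    let E , X , Y , W = total rs
    in + n * e + E , + n * x + X , + n * y + Y , + n * w + W

  total-nonneg : ∀ f rs → All (λ r → f ⊨ proj₂ r) rs → f ⊨ total rs
  total-nonneg f [] [] = ℤₚ.≤-reflexive (sym (zero-row (scale f) (x-coeff f) (y-coeff f) (const f)))
    where
    zero-row : ∀ d a b c → 0ℤ * d + 0ℤ * a + 0ℤ * b + 0ℤ * c ≡ 0ℤ
    zero-row = ℤR.solve-∀
  total-nonneg f ((n , e , x , y , w) ∷ rs) (h ∷ hs) =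
    subst (0ℤ ≤_) (sym (split (+ n) e x y w E X Y W (scale f) (x-coeff f) (y-coeff f) (const f)))
      (ℤₚ.+-mono-≤ n*≥0 (total-nonneg f rs hs))
    where
    E = proj₁ (total rs)
    X = proj₁ (proj₂ (total rs))
    Y = proj₁ (proj₂ (proj₂ (total rs)))
    W = proj₂ (proj₂ (proj₂ (total rs)))
    n*≥0 : 0ℤ ≤ + n * ((e , x , y , w) ∙ f)
    n*≥0 = subst (_≤ + n * ((e , x , y , w) ∙ f)) (ℤₚ.*-zeroʳ (+ n)) (ℤₚ.*-monoˡ-≤-nonNeg (+ n) h)
    split : ∀ n e x y w E X Y W d a b c →
      (n * e + E) * d + (n * x + X) * a + (n * y + Y) * b + (n * w + W) * c
      ≡ n * (e * d + x * a + y * b + w * c) + (E * d + X * a + Y * b + W * c)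
    split = ℤR.solve-∀

  isZero : ℤ → Bool
  isZero i = ⌊ i ℤₚ.≟ 0ℤ ⌋

  refutes : Row → Bool
  refutes (e , x , y , w) = ⌊ e ℤₚ.<? 0ℤ ⌋ ∧ (isZero x ∧ (isZero y ∧ isZero w))

  -- Only the term in the scale is left, with a negative weight, and scales are positive.
  refutes-sound : ∀ f r → T (refutes r) → f ⊨ r → ⊥
  refutes-sound f (e , x , y , w) t h = ℤₚ.<⇒≱ e*d<0 (subst (0ℤ ≤_) eq h)
    where
    open Equivalence
    t₁ = to Boolₚ.T-∧ t
    t₂ = to Boolₚ.T-∧ (proj₂ t₁)
    t₃ = to Boolₚ.T-∧ (proj₂ t₂)
    drop : ∀ e d a b c → e * d + 0ℤ * a + 0ℤ * b + 0ℤ * c ≡ e * d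
    drop = ℤR.solve-∀
    eq : (e , x , y , w) ∙ f ≡ e * scale f
    eq rewrite toWitness {a? = x ℤₚ.≟ 0ℤ} (proj₁ t₂)
             | toWitness {a? = y ℤₚ.≟ 0ℤ} (proj₁ t₃)
             | toWitness {a? = w ℤₚ.≟ 0ℤ} (proj₂ t₃)
      = drop e (scale f) (x-coeff f) (y-coeff f) (const f)
    e*d<0 : e * scale f < 0ℤ
    e*d<0 = ℤₚ.*-monoʳ-<-pos (scale f) {{ℤ.positive (scale>0 f)}} (toWitness {a? = e ℤₚ.<? 0ℤ} (proj₁ t₁))

  det : Row → Row → Row → ℤ
  det (_ , x₁ , y₁ , w₁) (_ , x₂ , y₂ , w₂) (_ , x₃ , y₃ , w₃) =
    x₁ * (y₂ * w₃ - y₃ * w₂) - y₁ * (x₂ * w₃ - x₃ * w₂) + w₁ * (x₂ * y₃ - x₃ * y₂)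

  -- By Cramer's rule the minors are the coefficients of the linear dependency
  -- between the last three components of four rows.
  weigh : Row → Row → Row → Row → Weighted
  weigh r₁ r₂ r₃ r₄ =
    (∣ det r₂ r₃ r₄ ∣ , r₁) ∷ (∣ det r₁ r₃ r₄ ∣ , r₂) ∷
    (∣ det r₁ r₂ r₄ ∣ , r₃) ∷ (∣ det r₁ r₂ r₃ ∣ , r₄) ∷ []

  select : ∀ {A : Set} → ℕ → List A → List (List A)
  select zero    xs       = [] ∷ []
  select (suc n) []       = []
  select (suc n) (x ∷ xs) = map (x ∷_) (select n xs) ++ select (suc n) xs

  select-All : ∀ {A : Set} {P : A → Set} n {xs} → All P xs → All (All P) (select n xs)
  select-All zero    ps       = [] ∷ []
  select-All (suc n) []       = []
  select-All (suc n) (p ∷ ps) =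
    ++⁺ (map⁺ (All.map (p ∷_) (select-All n ps))) (select-All (suc n) ps)

  -- `weigh` replaces the alternating signs of Cramer's rule by absolute values. Whether the
  -- combination still cancels is decided by computing it, so no sign condition has to be proved.
  refutes₄ : List Row → Bool
  refutes₄ (r₁ ∷ r₂ ∷ r₃ ∷ r₄ ∷ []) = refutes (total (weigh r₁ r₂ r₃ r₄))
  refutes₄ _                        = false

  refutes₄-sound : ∀ f rs → T (refutes₄ rs) → All (f ⊨_) rs → ⊥
  refutes₄-sound f (r₁ ∷ r₂ ∷ r₃ ∷ r₄ ∷ []) t (h₁ ∷ h₂ ∷ h₃ ∷ h₄ ∷ []) =
    refutes-sound f (total rs) t (total-nonneg f rs (h₁ ∷ h₂ ∷ h₃ ∷ h₄ ∷ []))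
    where rs = weigh r₁ r₂ r₃ r₄

  -- Dividing by the scale leaves three unknowns, so by Helly's theorem four rows at a time are
  -- enough to look for a contradiction.
  infeasible : List Row → Bool
  infeasible rs = any refutes₄ (select 4 rs)

  infeasible-sound : ∀ f rs → T (infeasible rs) → All (f ⊨_) rs → ⊥
  infeasible-sound f rs t hs =
    let _ , ∈rs , t′ = find (any⁻ refutes₄ (select 4 rs) t)
    in refutes₄-sound f _ t′ (All.lookup (select-All 4 hs) ∈rs)

  -- Coordinates of the walls

  Pt : Set
  Pt = ℤ × ℤ

  -- After division by d, the value is at least -1, respectively at most 1: the
  -- slack makes room for replacing real disks by rational ones.
  outside on : Pt → Row
  outside (x , y) = x * x + y * y + + 1 , x , y , + 1
  on (x , y) = + 1 - (x * x + y * y) , - x , - y , - + 1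

  -- The centre, at height - b / (2 d), is far above the lower wall.
  low : Row
  low = - + 128000 , 0ℤ , - + 1 , 0ℤ

  -- The distance of consecutive rungs, and the height of the line of hubs. A rung itself has length
  -- less than 9.
  S h : ℤ
  S = + 10000
  h = + 130000

  -- The perpendicular bisector of rung j has slope tilt j.  It matters that
  -- tilt j ≢ tilt (2 + j).
  tilt : ℕ → ℤ
  tilt 0 = + 3
  tilt 1 = + 3
  tilt 2 = + 4
  tilt 3 = + 4
  tilt (suc (suc (suc (suc j)))) = tilt j

  window : ℕ → Vec ℤ 5
  window b = tilt b ∷ tilt (1 ℕ.+ b) ∷ tilt (2 ℕ.+ b) ∷ tilt (3 ℕ.+ b) ∷ tilt (4 ℕ.+ b) ∷ []

  -- As `tilt` has period 4, a claim about five consecutive rungs anywhere on the wall comes down to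
  -- four cases.
  window-elim : (P : Vec ℤ 5 → Set) → P (window 0) → P (window 1) → P (window 2) → P (window 3) →
                ∀ b → P (window b)
  window-elim P p₀ p₁ p₂ p₃ 0 = p₀
  window-elim P p₀ p₁ p₂ p₃ 1 = p₁
  window-elim P p₀ p₁ p₂ p₃ 2 = p₂
  window-elim P p₀ p₁ p₂ p₃ 3 = p₃
  window-elim P p₀ p₁ p₂ p₃ (suc (suc (suc (suc b)))) = window-elim P p₀ p₁ p₂ p₃ b

  Rows : Set
  Rows = Vec ℤ 5 → List Row

  record Refuted (rows : Rows) : Set where
    constructor refuted
    field absurd : ∀ b f → All (f ⊨_) (rows (window b)) → ⊥
  open Refuted public

  -- For concrete `rows` the implicit arguments evaluate to the unit type, so the certificates below
  -- are found by type checking.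
  refute : ∀ {rows : Rows}
    {_ : T (infeasible (rows (window 0)))} {_ : T (infeasible (rows (window 1)))}
    {_ : T (infeasible (rows (window 2)))} {_ : T (infeasible (rows (window 3)))} →
    Refuted rows
  refute {rows} {t₀} {t₁} {t₂} {t₃} = refuted λ b f → infeasible-sound f (rows (window b))
    (window-elim (λ w → T (infeasible (rows w))) t₀ t₁ t₂ t₃ b)

  -- Coordinates relative to column `b`: the two points of a rung and the nearer point of the
  -- opposite wall above it. The rung has direction (- tilt , 1), so its bisector has slope tilt.
  u l t : Fin 5 → Vec ℤ 5 → Pt
  u o w = S * + toℕ o - lookup w o , + 1
  l o w = S * + toℕ o + lookup w o , - + 1
  t o w = S * + toℕ o - lookup w o , + 2 * h - + 1

  -- Points where two disks meet: each is forced into the interior of disks of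
  -- two kinds, which therefore cannot be disjoint.
  right-of-1 left-of-3 between between-high at-2 at-2′ at-2″ at-3 low-2 above-2 between-2-3 : Vec ℤ 5 → Pt
  right-of-1 w   = + 11000 , + 150
  left-of-3 w    = + 29000 , + 150
  between w      = + 15000 , - + 1
  between-high w = + 15000 , + 10000
  at-2 w         = + 20000 + (lookup w 1F - lookup w 3F) * + 1050 , (lookup w 1F - lookup w 3F) * + 300
  at-2′ w        = + 19710 - + 50 * lookup w 1F , - + 100
  at-2″ w        = + 19982 + + 60 * lookup w 1F , + 60
  at-3 w         = + 29958 + + 60 * lookup w 1F , - + 60
  low-2 w        = + 20540 , - + 100
  above-2 w      = + 20000 , + 15000
  between-2-3 w  = + 25000 , + 9500

  -- Local facts about at most five consecutive rungs

  inner-not-l : Refuted (λ w → on (l 1F w) ∷ low ∷ outside (u 1F w) ∷ outside (u 2F w) ∷ [])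
  inner-not-l = refute

  -- The centre is near abscissa 15000. It should be above the bisector of rung 1, so at height
  -- about 15000 or more, and below that of rung 2, so at about - 15000 or less.
  no-descent : Refuted (λ w → on (u 1F w) ∷ on (l 2F w) ∷ outside (l 1F w) ∷ outside (u 2F w) ∷ [])
  no-descent = refute

  -- `u 0F` keeps the abscissa of the centre above about 5000, and its height is at least 64000, so
  -- the boundary rises by less than 150 over the 1000 to the right of rung 1.
  inner-right : Refuted (λ w → on (u 1F w) ∷ low ∷ outside (right-of-1 w) ∷ outside (u 0F w) ∷ [])
  inner-right = refute

  -- The centre is near abscissa 15000, and `l 2F` keeps it above the bisector of rung 2, at height
  -- about - 20000 or more: not low enough to avoid `right-of-1`.
  ascent-right : Refuted
    (λ w → on (l 1F w) ∷ on (u 2F w) ∷ outside (right-of-1 w) ∷ outside (l 2F w) ∷ [])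
  ascent-right = refute

  lower-between : Refuted
    (λ w → on (l 1F w) ∷ on (l 2F w) ∷ outside (between w) ∷ outside (u 1F w) ∷ [])
  lower-between = refute

  -- The point `between` is only 2 below the chord. It could be avoided only by a very high centre,
  -- which would bring `t 1F` into the disk.
  upper-between : Refuted
    (λ w → on (u 1F w) ∷ on (u 2F w) ∷ outside (between w) ∷ outside (t 1F w) ∷ [])
  upper-between = refute

  inner-right-high : Refuted
    (λ w → on (u 1F w) ∷ low ∷ outside (between-high w) ∷ outside (u 0F w) ∷ [])
  inner-right-high = refute

  inner-left-high : Refuted
    (λ w → on (u 2F w) ∷ low ∷ outside (between-high w) ∷ outside (l 2F w) ∷ [])
  inner-left-high = refute

  -- A disk through both points of rung 1 is centred on its bisector, so at rung 2 its boundary has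
  -- slope about 1 / tilt of rung 1. For `full-left-at-2` the slope is about 1 / tilt of rung 3. As
  -- 1/4 < 300/1050 < 1/3, the point `at-2` lies in the wedge where the two disks overlap, on the
  -- side given by the sign of the difference.
  full-right-at-2 : Refuted
    (λ w → on (u 1F w) ∷ on (l 1F w) ∷ on (u 2F w) ∷
           outside (at-2 w) ∷ outside (u 1F w) ∷ outside (l 1F w) ∷ [])
  full-right-at-2 = refute

  full-left-at-2 : Refuted
    (λ w → on (l 2F w) ∷ on (u 3F w) ∷ on (l 3F w) ∷
           outside (at-2 w) ∷ outside (u 3F w) ∷ outside (l 3F w) ∷ [])
  full-left-at-2 = refute

  inner-left : Refuted (λ w → on (u 3F w) ∷ low ∷ outside (left-of-3 w) ∷ outside (u 4F w) ∷ [])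
  inner-left = refute

  -- `u 1F` keeps the centre below the bisector of rung 1, so the disk reaches below the axis just
  -- left of rung 2.
  full-right-at-2′ : Refuted
    (λ w → on (l 1F w) ∷ on (u 2F w) ∷ outside (at-2′ w) ∷ outside (u 1F w) ∷ [])
  full-right-at-2′ = refute

  -- Avoiding `left-of-3` pushes the centre down to about - 30000 or lower, so that the disk bulges
  -- to the left of rung 2.
  lower-at-2′ : Refuted
    (λ w → on (l 2F w) ∷ on (l 3F w) ∷ outside (left-of-3 w) ∷ outside (at-2′ w) ∷ [])
  lower-at-2′ = refute

  -- The centre is above the bisector of rung 1, so the boundary at rung 2 has slope at most about 1
  -- / tilt of rung 1. The point `at-2″` is just above a line of that slope.
  full-right-at-2″ : Refuted
    (λ w → on (u 1F w) ∷ on (u 2F w) ∷ outside (at-2″ w) ∷ outside (l 1F w) ∷ [])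
  full-right-at-2″ = refute

  full-right-between : Refuted
    (λ w → on (u 1F w) ∷ on (u 2F w) ∷ outside (between-2-3 w) ∷ outside (l 1F w) ∷ [])
  full-right-between = refute

  -- Avoiding `at-2″` forces a centre well below the axis, so the boundary falls at rung 3, and
  -- `at-3` is beneath it.
  ascent-at-3 : Refuted
    (λ w → on (l 2F w) ∷ on (u 3F w) ∷ outside (at-2″ w) ∷ outside (at-3 w) ∷ [])
  ascent-at-3 = refute

  lower-at-3 : Refuted (λ w → on (l 2F w) ∷ on (l 3F w) ∷ outside (at-2″ w) ∷ outside (at-3 w) ∷ [])
  lower-at-3 = refute

  -- Avoiding `at-3` forces a centre well above the axis, and the disk overhangs rung 3 to the left
  -- as far as `between-2-3`.
  upper-between-2-3 : Refuted
    (λ w → on (u 3F w) ∷ on (u 4F w) ∷ outside (at-3 w) ∷ outside (between-2-3 w) ∷ [])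
  upper-between-2-3 = refute

  ascent-between-2-3 : Refuted
    (λ w → on (l 3F w) ∷ on (u 4F w) ∷ outside (at-3 w) ∷ outside (between-2-3 w) ∷ [])
  ascent-between-2-3 = refute

  lower-between-2-3 : Refuted
    (λ w → on (l 3F w) ∷ on (l 4F w) ∷ outside (at-3 w) ∷ outside (between-2-3 w) ∷ [])
  lower-between-2-3 = refute

  -- As in `lower-at-2′`, the disk is pushed down, here by `right-of-1`, and bulges beyond `low-2`
  -- on the right of rung 2.
  lower-low-2 : Refuted
    (λ w → on (l 1F w) ∷ on (l 2F w) ∷ outside (right-of-1 w) ∷
           outside (low-2 w) ∷ outside (u 1F w) ∷ [])
  lower-low-2 = refute

  inner-above-2 : Refuted (λ w → on (u 1F w) ∷ low ∷ outside (above-2 w) ∷ outside (u 0F w) ∷ [])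
  inner-above-2 = refute

  upper-above-2 : Refuted
    (λ w → on (u 2F w) ∷ on (u 3F w) ∷ outside (low-2 w) ∷ outside (above-2 w) ∷ [])
  upper-above-2 = refute

-- Disks touching a row of points, and the height of their centres

module Rows where

  open Forms
  open import Data.Integer.Base using (_+_; _-_; _*_; -_; _≤_; _<_; +≤+; -<+; positive; nonNegative)
  open Form

  infixl 6 _⊹_
  _⊹_ : ∀ {i j} → 0ℤ ≤ i → 0ℤ ≤ j → 0ℤ ≤ i + j
  _⊹_ = ℤₚ.+-mono-≤

  0≤n : ∀ n → 0ℤ ≤ + n
  0≤n n = +≤+ z≤n

  0≤-* : ∀ {i j} → 0ℤ ≤ i → 0ℤ ≤ j → 0ℤ ≤ i * j
  0≤-* {i} {j} 0≤i 0≤j =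
    subst (_≤ i * j) (ℤₚ.*-zeroʳ i) (ℤₚ.*-monoˡ-≤-nonNeg i {{nonNegative 0≤i}} 0≤j)

  nonneg : ∀ {i} → ¬ (i ≤ 0ℤ) → 0ℤ ≤ i
  nonneg i≰0 = ℤₚ.<⇒≤ (ℤₚ.≰⇒> i≰0)

  scale≥0 : ∀ f → 0ℤ ≤ scale f
  scale≥0 f = ℤₚ.<⇒≤ (scale>0 f)

  scale-negative : ∀ f c → c < 0ℤ → 0ℤ ≤ c * scale f → ⊥
  scale-negative f c c<0 = ℤₚ.<⇒≱ c*d<0
    where
    c*d<0 : c * scale f < 0ℤ
    c*d<0 = ℤₚ.*-monoʳ-<-pos (scale f) {{positive (scale>0 f)}} {c} {+ 0} c<0

  scale-absurd : ∀ f {n} → 0ℤ ≤ -[1+ n ] * scale f → ⊥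
  scale-absurd f {n} = ℤₚ.<⇒≱ n*d<0
    where
    n*d<0 : -[1+ n ] * scale f < 0ℤ
    n*d<0 = ℤₚ.*-monoʳ-<-pos (scale f) {{positive (scale>0 f)}} { -[1+ n ]} {+ 0} (-<+ {n} {0})

  -- Strict convexity along the row: the weights of the outer points are those expressing the middle
  -- point as their convex combination. Gaps of at least 2 outweigh the slack in `on` and `outside`.
  collinear : ∀ f x p q y → 0ℤ ≤ p → 0ℤ ≤ q →
    f ⊨ on (x , y) → f ⊨ outside (x + (p + + 2) , y) → f ⊨ on (x + (p + + 2) + (q + + 2) , y) → ⊥
  collinear f x p q y 0≤p 0≤q h₁ h₂ h₃ = scale-absurd f {7}
    (subst (0ℤ ≤_) (identity x p q y (scale f) (x-coeff f) (y-coeff f) (const f))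
      (0≤-* (0≤q ⊹ 0≤n 2) h₁ ⊹ 0≤-* (0≤p ⊹ 0≤n 2) h₃ ⊹ 0≤-* (0≤p ⊹ (0≤q ⊹ 0≤n 4)) h₂ ⊹
       0≤-* (0≤-* (0≤n 10) 0≤p ⊹ 0≤-* (0≤n 10) 0≤q ⊹
             (0≤-* (0≤p ⊹ 0≤q) (0≤p ⊹ 0≤p ⊹ (0≤q ⊹ 0≤q)) ⊹ 0≤-* (0≤-* 0≤p 0≤q) (0≤p ⊹ 0≤q ⊹ 0≤n 4)))
            (scale≥0 f)))
    where
    identity : ∀ x p q y d a b c →
      (q + + 2) * ((+ 1 - (x * x + y * y)) * d + - x * a + - y * b + - + 1 * c)
      + (p + + 2) * ((+ 1 - ((x + (p + + 2) + (q + + 2)) * (x + (p + + 2) + (q + + 2)) + y * y)) * d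
                     + - (x + (p + + 2) + (q + + 2)) * a + - y * b + - + 1 * c)
      + (p + (q + + 4)) * (((x + (p + + 2)) * (x + (p + + 2)) + y * y + + 1) * d + (x + (p + + 2)) * a + y * b + + 1 * c)
      + (+ 10 * p + + 10 * q + ((p + q) * (p + p + (q + q)) + p * q * (p + q + + 4))) * d
      ≡ -[1+ 7 ] * d
    identity = ℤR.solve-∀

  shift : ℤ → Form → Form
  shift s f = form (scale f) (x-coeff f + + 2 * s * scale f) (y-coeff f)
    (const f + s * s * scale f + s * x-coeff f) (scale>0 f)

  shift-outside : ∀ s f x y → outside (x , y) ∙ shift s f ≡ outside (s + x , y) ∙ f
  shift-outside s f x y = eq s x y (scale f) (x-coeff f) (y-coeff f) (const f)
    where
    eq : ∀ s x y d a b c →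
      (x * x + y * y + + 1) * d + x * (a + + 2 * s * d) + y * b + + 1 * (c + s * s * d + s * a)
      ≡ ((s + x) * (s + x) + y * y + + 1) * d + (s + x) * a + y * b + + 1 * c
    eq = ℤR.solve-∀

  shift-on : ∀ s f x y → on (x , y) ∙ shift s f ≡ on (s + x , y) ∙ f
  shift-on s f x y = eq s x y (scale f) (x-coeff f) (y-coeff f) (const f)
    where
    eq : ∀ s x y d a b c →
      (+ 1 - (x * x + y * y)) * d + - x * (a + + 2 * s * d) + - y * b + - + 1 * (c + s * s * d + s * a)
      ≡ (+ 1 - ((s + x) * (s + x) + y * y)) * d + - (s + x) * a + - y * b + - + 1 * c
    eq = ℤR.solve-∀

  shift-low : ∀ s f → low ∙ shift s f ≡ low ∙ f
  shift-low s f = eq s (scale f) (x-coeff f) (y-coeff f) (const f)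
    where
    eq : ∀ s d a b c →
      - + 128000 * d + 0ℤ * (a + + 2 * s * d) + - + 1 * b + 0ℤ * (c + s * s * d + s * a)
      ≡ - + 128000 * d + 0ℤ * a + - + 1 * b + 0ℤ * c
    eq = ℤR.solve-∀

  -- Adding the two conditions confines the centre to abscissa at most 5005, about half the distance
  -- of the points. Since that distance is at least 20, the slack divided by it is below 1, which
  -- turns 10009 into 10010.
  x-coeff-bound : ∀ f y x → 0ℤ ≤ x → x ≤ + 9989 →
    f ⊨ on (0ℤ , y) → f ⊨ outside (x + + 20 , y) → 0ℤ ≤ x-coeff f + + 10010 * scale f
  x-coeff-bound f y x 0≤x x≤ h₁ h₂ = nonneg λ ≤0 → scale-absurd f {17}
    (subst (0ℤ ≤_) (identity x y (scale f) (x-coeff f) (y-coeff f) (const f))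
      (h₁ ⊹ h₂ ⊹ 0≤-* (0≤x ⊹ 0≤n 20) (ℤₚ.neg-mono-≤ ≤0) ⊹ 0≤-* (0≤-* (0≤x ⊹ 0≤n 20) (ℤₚ.i≤j⇒0≤j-i x≤)) (scale≥0 f)
       ⊹ 0≤-* 0≤x (scale≥0 f)))
    where
    identity : ∀ x y d a b c →
      ((+ 1 - (0ℤ * 0ℤ + y * y)) * d + - 0ℤ * a + - y * b + - + 1 * c)
      + (((x + + 20) * (x + + 20) + y * y + + 1) * d + (x + + 20) * a + y * b + + 1 * c)
      + (x + + 20) * - (a + + 10010 * d) + (x + + 20) * (+ 9989 - x) * d + x * d
      ≡ -[1+ 17 ] * d
    identity = ℤR.solve-∀

  mirror : Form → Form
  mirror f = form (scale f) (- x-coeff f) (y-coeff f) (const f) (scale>0 f)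

  mirror-outside : ∀ f x y → outside (x , y) ∙ mirror f ≡ outside (- x , y) ∙ f
  mirror-outside f x y = eq x y (scale f) (x-coeff f) (y-coeff f) (const f)
    where
    eq : ∀ x y d a b c →
      (x * x + y * y + + 1) * d + x * - a + y * b + + 1 * c
      ≡ (- x * - x + y * y + + 1) * d + - x * a + y * b + + 1 * c
    eq = ℤR.solve-∀

  mirror-on : ∀ f x y → on (x , y) ∙ mirror f ≡ on (- x , y) ∙ f
  mirror-on f x y = eq x y (scale f) (x-coeff f) (y-coeff f) (const f)
    where
    eq : ∀ x y d a b c →
      (+ 1 - (x * x + y * y)) * d + - x * - a + - y * b + - + 1 * c
      ≡ (+ 1 - (- x * - x + y * y)) * d + - - x * a + - y * b + - + 1 * c
    eq = ℤR.solve-∀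

  square≥0 : ∀ i → 0ℤ ≤ i * i
  square≥0 (+ n)    = subst (0ℤ ≤_) (ℤₚ.pos-* n n) (0≤n (n ℕ.* n))
  square≥0 -[1+ n ] = 0≤n (suc n ℕ.* suc n)

  -- This bounds the height of the centre of a disk touching (0 , y) and (X , Z)
  -- with Z ≥ H by about H / 2.  The horizontal displacement only enters through
  -- (2 X - K)² ≥ 0.
  low-identity : ∀ y X Z d a b c K T H →
    + 4 * (((0ℤ * 0ℤ + y * y + + 1) * d + 0ℤ * a + y * b + + 1 * c)
           + ((+ 1 - (X * X + Z * Z)) * d + - X * a + - Z * b + - + 1 * c))
    + + 4 * (X * (a + K * d))
    + + 4 * ((Z - y) * - (- T * d + 0ℤ * a + - + 1 * b + 0ℤ * c))
    + (+ 2 * X - K) * (+ 2 * X - K) * d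
    + + 4 * ((Z - H) * (Z - T + H)) * d
    + (+ 4 * T * (y - - + 1) + + 4 * ((y - - + 1) * (+ 1 - y))) * d
    ≡ (+ 12 + K * K - + 4 * (H * H) + + 4 * (H * T) + + 4 * T) * d
  low-identity = ℤR.solve-∀

  low-bound⁺ : ∀ f y X Z → y ≤ + 1 → - + 1 ≤ y → 0ℤ ≤ X → h ≤ Z →
    0ℤ ≤ x-coeff f + + 10010 * scale f →
    f ⊨ outside (0ℤ , y) → f ⊨ on (X , Z) → f ⊨ low
  low-bound⁺ f y X Z y≤1 -1≤y 0≤X h≤Z 0≤A h₁ h₂ = nonneg λ ≤0 → scale-negative f
    -- Negative because 128000 falls short of `h` by 2000: the product 4 * 2000 * h exceeds 10010²
    -- and the slack.
    (+ 12 + + 10010 * + 10010 - + 4 * (h * h) + + 4 * (h * + 128000) + + 4 * + 128000) -<+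
    (subst (0ℤ ≤_) (low-identity y X Z (scale f) (x-coeff f) (y-coeff f) (const f) (+ 10010) (+ 128000) h)
      (0≤-* (0≤n 4) (h₁ ⊹ h₂) ⊹ 0≤-* (0≤n 4) (0≤-* 0≤X 0≤A)
       ⊹ 0≤-* (0≤n 4) (0≤-* (ℤₚ.i≤j⇒0≤j-i y≤Z) (ℤₚ.neg-mono-≤ ≤0))
       ⊹ 0≤-* (square≥0 (+ 2 * X - + 10010)) (scale≥0 f)
       ⊹ 0≤-* (0≤-* (0≤n 4) (0≤-* (ℤₚ.i≤j⇒0≤j-i h≤Z) (ℤₚ.i≤j⇒0≤j-i T≤Z ⊹ 0≤h))) (scale≥0 f)
       ⊹ 0≤-* (0≤-* 0≤4T (ℤₚ.i≤j⇒0≤j-i -1≤y)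
               ⊹ 0≤-* (0≤n 4) (0≤-* (ℤₚ.i≤j⇒0≤j-i -1≤y) (ℤₚ.i≤j⇒0≤j-i y≤1))) (scale≥0 f)))
    where
    0≤h : 0ℤ ≤ h
    0≤h = 0≤n 130000
    0≤4T : 0ℤ ≤ + 4 * + 128000
    0≤4T = 0≤n 512000
    y≤Z : y ≤ Z
    y≤Z = ℤₚ.≤-trans y≤1 (ℤₚ.≤-trans (toWitness {a? = + 1 ℤₚ.≤? h} _) h≤Z)
    T≤Z : + 128000 ≤ Z
    T≤Z = ℤₚ.≤-trans (toWitness {a? = + 128000 ℤₚ.≤? h} _) h≤Z

  on-shift : ∀ s f x x′ y → x ≡ s + x′ → f ⊨ on (x , y) → shift s f ⊨ on (x′ , y)
  on-shift s f _ x′ y refl = subst (0ℤ ≤_) (sym (shift-on s f x′ y))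

  outside-shift : ∀ s f x x′ y → x ≡ s + x′ → f ⊨ outside (x , y) → shift s f ⊨ outside (x′ , y)
  outside-shift s f _ x′ y refl = subst (0ℤ ≤_) (sym (shift-outside s f x′ y))

  -- Neighbours on both sides of the touched point confine the centre from both sides, so a high
  -- point to the left is handled by reflection.
  low-bound₀ : ∀ f y X Z e e′ → y ≤ + 1 → - + 1 ≤ y → h ≤ Z →
    0ℤ ≤ e → e ≤ + 9989 → 0ℤ ≤ e′ → e′ ≤ + 9989 →
    f ⊨ on (0ℤ , y) → f ⊨ outside (0ℤ , y) → f ⊨ outside (e + + 20 , y) → f ⊨ outside (- (e′ + + 20) , y) →
    f ⊨ on (X , Z) → f ⊨ low
  low-bound₀ f y X Z e e′ y≤1 -1≤y h≤Z 0≤e e≤ 0≤e′ e′≤ h₁ h₂ h₃ h₄ h₅ = [ right , left ]′ (ℤₚ.≤-total 0ℤ X)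
    where
    right : 0ℤ ≤ X → f ⊨ low
    right 0≤X = low-bound⁺ f y X Z y≤1 -1≤y 0≤X h≤Z (x-coeff-bound f y e 0≤e e≤ h₁ h₃) h₂ h₅
    g = mirror f
    left : X ≤ 0ℤ → f ⊨ low
    left X≤0 = subst (0ℤ ≤_) (mirror-low f) (low-bound⁺ g y (- X) Z y≤1 -1≤y (ℤₚ.neg-mono-≤ X≤0) h≤Z
      (x-coeff-bound g y e′ 0≤e′ e′≤ (subst (0ℤ ≤_) (sym (mirror-on f 0ℤ y)) h₁)
                                     (subst (0ℤ ≤_) (sym (mirror-outside f (e′ + + 20) y)) h₄))
      (subst (0ℤ ≤_) (sym (mirror-outside f 0ℤ y)) h₂)
      (subst (0ℤ ≤_) (sym (trans (mirror-on f (- X) Z) (cong (λ x → on (x , Z) ∙ f) (ℤₚ.neg-involutive X)))) h₅))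
      where
      mirror-low : ∀ f → low ∙ mirror f ≡ low ∙ f
      mirror-low f = eq (scale f) (x-coeff f) (y-coeff f) (const f)
        where
        eq : ∀ d a b c → - + 128000 * d + 0ℤ * - a + - + 1 * b + 0ℤ * c
                       ≡ - + 128000 * d + 0ℤ * a + - + 1 * b + 0ℤ * c
        eq = ℤR.solve-∀

  record Small (i : ℤ) : Set where
    constructor small
    field
      -4≤ : - + 4 ≤ i
      ≤4  : i ≤ + 4
  open Small

  small-tilt : ∀ j → Small (tilt j)
  small-tilt 0 = small (toWitness {a? = _ ℤₚ.≤? _} _) (toWitness {a? = _ ℤₚ.≤? _} _)
  small-tilt 1 = small (toWitness {a? = _ ℤₚ.≤? _} _) (toWitness {a? = _ ℤₚ.≤? _} _)
  small-tilt 2 = small (toWitness {a? = _ ℤₚ.≤? _} _) (toWitness {a? = _ ℤₚ.≤? _} _)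
  small-tilt 3 = small (toWitness {a? = _ ℤₚ.≤? _} _) (toWitness {a? = _ ℤₚ.≤? _} _)
  small-tilt (suc (suc (suc (suc j)))) = small-tilt j

  small-neg : ∀ {i} → Small i → Small (- i)
  small-neg (small p q) = small (ℤₚ.neg-mono-≤ q) (ℤₚ.neg-mono-≤ p)

  small-0≤ : ∀ {i} → Small i → 0ℤ ≤ i + + 4
  small-0≤ {i} (small p _) = subst (0ℤ ≤_) (ℤₚ.+-comm (+ 4) i) (subst (_≤ + 4 + i) refl (ℤₚ.+-monoʳ-≤ (+ 4) p))

  small-≤0 : ∀ {i} → Small i → 0ℤ ≤ + 4 - i
  small-≤0 (small _ q) = ℤₚ.i≤j⇒0≤j-i q

  low-bound : ∀ f j o₀ o₁ o₂ y X Z → y ≤ + 1 → - + 1 ≤ y → h ≤ Z → Small o₀ → Small o₁ → Small o₂ →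
    f ⊨ outside (S * + j + o₀ , y) →
    f ⊨ outside (S * + (1 ℕ.+ j) + o₁ , y) → f ⊨ on (S * + (1 ℕ.+ j) + o₁ , y) →
    f ⊨ outside (S * + (2 ℕ.+ j) + o₂ , y) → f ⊨ on (X , Z) → f ⊨ low
  low-bound f j o₀ o₁ o₂ y X Z y≤1 -1≤y h≤Z s₀ s₁ s₂ h₀ h₁ h₁′ h₂ h₃ =
    subst (0ℤ ≤_) (shift-low s f)
      (low-bound₀ (shift s f) y (X - s) Z e e′ y≤1 -1≤y h≤Z
        (subst (0ℤ ≤_) (eq₁ o₂ o₁) (0≤n 9972 ⊹ small-0≤ s₂ ⊹ small-≤0 s₁))
        (ℤₚ.0≤i-j⇒j≤i (subst (0ℤ ≤_) (eq₂ o₂ o₁) (0≤n 1 ⊹ small-≤0 s₂ ⊹ small-0≤ s₁)))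
        (subst (0ℤ ≤_) (eq₁ o₁ o₀) (0≤n 9972 ⊹ small-0≤ s₁ ⊹ small-≤0 s₀))
        (ℤₚ.0≤i-j⇒j≤i (subst (0ℤ ≤_) (eq₂ o₁ o₀) (0≤n 1 ⊹ small-≤0 s₁ ⊹ small-0≤ s₀)))
        (on-shift s f s 0ℤ y (sym (ℤₚ.+-identityʳ s)) h₁′)
        (outside-shift s f s 0ℤ y (sym (ℤₚ.+-identityʳ s)) h₁)
        (outside-shift s f _ (e + + 20) y (eq₃ (+ j) o₁ o₂) h₂)
        (outside-shift s f _ (- (e′ + + 20)) y (eq₄ (+ j) o₀ o₁) h₀)
        (on-shift s f X (X - s) Z (eq₅ X s) h₃))
    where
    s = S * + (1 ℕ.+ j) + o₁
    -- The neighbouring point is at distance e + 20, between 9992 and 10008, as the offsets are at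
    -- most 4.
    e = + 9980 + o₂ - o₁
    e′ = + 9980 + o₁ - o₀
    eq₁ : ∀ a b → + 9972 + (a + + 4) + (+ 4 - b) ≡ + 9980 + a - b
    eq₁ = ℤR.solve-∀
    eq₂ : ∀ a b → + 1 + (+ 4 - a) + (b + + 4) ≡ + 9989 - (+ 9980 + a - b)
    eq₂ = ℤR.solve-∀
    eq₃ : ∀ j a b → + 10000 * (+ 2 + j) + b ≡ + 10000 * (+ 1 + j) + a + (+ 9980 + b - a + + 20)
    eq₃ = ℤR.solve-∀
    eq₄ : ∀ j a b → + 10000 * j + a ≡ + 10000 * (+ 1 + j) + b + - (+ 9980 + b - a + + 20)
    eq₄ = ℤR.solve-∀
    eq₅ : ∀ X s → X ≡ s + (X - s)
    eq₅ = ℤR.solve-∀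

  apart-in-row : ∀ f j m o₀ o₁ o₂ y → Small o₀ → Small o₁ → Small o₂ →
    f ⊨ on (S * + j + o₀ , y) → f ⊨ outside (S * + (1 ℕ.+ j) + o₁ , y) →
    f ⊨ on (S * + (2 ℕ.+ j ℕ.+ m) + o₂ , y) → ⊥
  apart-in-row f j m o₀ o₁ o₂ y s₀ s₁ s₂ h₀ h₁ h₂ = collinear f x p q y
    (subst (0ℤ ≤_) (eq₁ o₁ o₀) (0≤n 9990 ⊹ small-0≤ s₁ ⊹ small-≤0 s₀))
    (subst (0ℤ ≤_) (eq₂ (+ m) o₂ o₁) (0≤n 9990 ⊹ 0≤-* (0≤n 10000) (0≤n m) ⊹ small-0≤ s₂ ⊹ small-≤0 s₁))
    h₀
    (subst (λ x → f ⊨ outside (x , y)) (eq₃ (+ j) o₀ o₁) h₁)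
    (subst (λ x → f ⊨ on (x , y)) (eq₄ (+ j) (+ m) o₀ o₁ o₂) h₂)
    where
    x = S * + j + o₀
    p = + 9998 + o₁ - o₀
    q = + 9998 + + 10000 * + m + o₂ - o₁
    eq₁ : ∀ a b → + 9990 + (a + + 4) + (+ 4 - b) ≡ + 9998 + a - b
    eq₁ = ℤR.solve-∀
    eq₂ : ∀ m a b → + 9990 + + 10000 * m + (a + + 4) + (+ 4 - b) ≡ + 9998 + + 10000 * m + a - b
    eq₂ = ℤR.solve-∀
    eq₃ : ∀ j a b → + 10000 * (+ 1 + j) + b ≡ + 10000 * j + a + (+ 9998 + b - a + + 2)
    eq₃ = ℤR.solve-∀
    eq₄ : ∀ j m a b c → + 10000 * (+ 2 + j + m) + c
      ≡ + 10000 * j + a + (+ 9998 + b - a + + 2) + (+ 9998 + + 10000 * m + c - b + + 2)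
    eq₄ = ℤR.solve-∀

-- Charging the rungs of one wall

module Walls where

  open Forms
  open Rows
  open import Data.Integer.Base using (_+_; _-_; _*_; -_; _≤_; ∣_∣; -≤+)
  open Form

  U L Top : ℕ → Pt
  U j = S * + j - tilt j , + 1
  L j = S * + j + tilt j , - + 1
  Top j = S * + j - tilt j , + 2 * h - + 1

  -- `on` is only an upper bound on the value, which decreases downwards near a wall when the centre
  -- is below the axis.
  on-lower : ∀ f x → 0ℤ ≤ y-coeff f → f ⊨ on (x , + 1) → f ⊨ on (x , - + 1)
  on-lower f x 0≤b h₁ = subst (0ℤ ≤_) (eq x (scale f) (x-coeff f) (y-coeff f) (const f)) (h₁ ⊹ 0≤-* (0≤n 2) 0≤b)
    where
    eq : ∀ x d a b c →
      ((+ 1 - (x * x + + 1 * + 1)) * d + - x * a + - + 1 * b + - + 1 * c) + + 2 * b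
      ≡ (+ 1 - (x * x + - + 1 * - + 1)) * d + - x * a + - - + 1 * b + - + 1 * c
    eq = ℤR.solve-∀

  on-raise : ∀ f x → y-coeff f ≤ 0ℤ → f ⊨ on (x , - + 1) → f ⊨ on (x , + 1)
  on-raise f x b≤0 h₁ = subst (0ℤ ≤_) (eq x (scale f) (x-coeff f) (y-coeff f) (const f))
    (h₁ ⊹ 0≤-* (0≤n 2) (ℤₚ.neg-mono-≤ b≤0))
    where
    eq : ∀ x d a b c →
      ((+ 1 - (x * x + - + 1 * - + 1)) * d + - x * a + - - + 1 * b + - + 1 * c) + + 2 * - b
      ≡ (+ 1 - (x * x + + 1 * + 1)) * d + - x * a + - + 1 * b + - + 1 * c
    eq = ℤR.solve-∀

  -- A j and B j are disks touching the upper and the lower point of rung j.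
  module Touching {k : ℕ} (A B : ℕ → Fin k) (Inner : Fin k → Set) where

    Own : ℕ → Fin k → Set
    Own j i = A j ≡ i ⊎ B j ≡ i

    -- The rung has only this one disk that is not inner, so it has no alternative to being charged
    -- with it.
    End : ℕ → Fin k → Set
    End j i = ¬ Inner i × B j ≡ i × (A j ≡ i ⊎ Inner (A j))

    -- The vertical order of the two disks is left open. By convention the first is shared with the
    -- rung on the left and the second with the rung on the right.
    Middle : ℕ → Fin k → Fin k → Set
    Middle j i i′ = (A j ≡ i × B j ≡ i′) ⊎ (A j ≡ i′ × B j ≡ i)

    -- The geometry enters only through these parameters; the rest is combinatorics. The bounds on
    -- `b` keep all rungs involved inside the wall.
    module Charging (N : ℕ) (inner? : ∀ i → Dec (Inner i))
      (not-adjacent : ∀ {i} j {j′} → 2 ℕ.+ j ℕ.≤ j′ → j′ ℕ.< N → Own j i → Own j′ i → ⊥)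
      (inner-upper : ∀ b → 4 ℕ.+ b ℕ.< N → ¬ Inner (B (1 ℕ.+ b)))
      (not-both-left : ∀ b → 4 ℕ.+ b ℕ.< N → A (2 ℕ.+ b) ≢ B (2 ℕ.+ b) →
        Own (1 ℕ.+ b) (A (2 ℕ.+ b)) → Own (1 ℕ.+ b) (B (2 ℕ.+ b)) → ⊥)
      (not-both-right : ∀ b → 4 ℕ.+ b ℕ.< N → A (1 ℕ.+ b) ≢ B (1 ℕ.+ b) →
        Own (2 ℕ.+ b) (A (1 ℕ.+ b)) → Own (2 ℕ.+ b) (B (1 ℕ.+ b)) → ⊥)
      (end-end : ∀ b {i} → 4 ℕ.+ b ℕ.< N → End (1 ℕ.+ b) i → End (2 ℕ.+ b) i → ⊥)
      (end-middle-end : ∀ b {i i′} → 5 ℕ.+ b ℕ.< N → i ≢ i′ →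
        End (1 ℕ.+ b) i → Middle (2 ℕ.+ b) i i′ → End (3 ℕ.+ b) i′ → ⊥)
      (end-middle-middle : ∀ b {i i′ i″} → 6 ℕ.+ b ℕ.< N → i ≢ i′ → i′ ≢ i″ → i ≢ i″ → ¬ Inner i′ →
        End (1 ℕ.+ b) i → Middle (2 ℕ.+ b) i i′ → Middle (3 ℕ.+ b) i′ i″ → Own (4 ℕ.+ b) i″ → ⊥)
      where

      own? : ∀ j i → Dec (Own j i)
      own? j i = (A j Finₚ.≟ i) ⊎-dec (B j Finₚ.≟ i)

      -- Claim m i: the disk i is charged to rung 1 + m.
      data Claim (m : ℕ) (i : Fin k) : Set where
        pure  : Own (1 ℕ.+ m) i → ¬ Inner i → ¬ Own m i → ¬ Own (2 ℕ.+ m) i → Claim m i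
        end   : End (1 ℕ.+ m) i → Claim m i
        left  : ∀ i′ → Middle (1 ℕ.+ m) i i′ → Own m i → Own (2 ℕ.+ m) i′ → ¬ Inner i → ¬ End m i → Claim m i
        right : ∀ i′ → Middle (1 ℕ.+ m) i′ i → Own m i′ → Own (2 ℕ.+ m) i → ¬ Inner i → End m i′ → Claim m i

      middle-ownˡ : ∀ {j i i′} → Middle j i i′ → Own j i
      middle-ownˡ (inj₁ (a , _)) = inj₁ a
      middle-ownˡ (inj₂ (_ , b)) = inj₂ b

      middle-ownʳ : ∀ {j i i′} → Middle j i i′ → Own j i′
      middle-ownʳ (inj₁ (_ , b)) = inj₂ b
      middle-ownʳ (inj₂ (a , _)) = inj₁ a

      claim-own : ∀ {m i} → Claim m i → Own (1 ℕ.+ m) i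
      claim-own (pure o _ _ _)            = o
      claim-own (end (_ , b , _))         = inj₂ b
      claim-own (left _ mid _ _ _ _)      = middle-ownˡ mid
      claim-own (right _ mid _ _ _ _)     = middle-ownʳ mid

      claim-outer : ∀ {m i} → Claim m i → ¬ Inner i
      claim-outer (pure _ ¬inner _ _)      = ¬inner
      claim-outer (end (¬inner , _))       = ¬inner
      claim-outer (left _ _ _ _ ¬inner _)  = ¬inner
      claim-outer (right _ _ _ _ ¬inner _) = ¬inner

      end? : ∀ j i → Dec (End j i)
      end? j i = ¬? (inner? i) ×-dec ((B j Finₚ.≟ i) ×-dec ((A j Finₚ.≟ i) ⊎-dec inner? (A j)))

      neighbours-apart : ∀ b {i i′} → 4 ℕ.+ b ℕ.< N → Own (1 ℕ.+ b) i → Own (3 ℕ.+ b) i′ → i ≢ i′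
      neighbours-apart b lt o o′ refl = not-adjacent (1 ℕ.+ b) ℕₚ.≤-refl (ℕₚ.<-trans (ℕₚ.n<1+n _) lt) o o′

      private
        data Kind (m : ℕ) (i : Fin k) : Set where
          inner′ : Inner i → Kind m i
          alone  : ¬ Inner i → ¬ Own m i → ¬ Own (2 ℕ.+ m) i → Kind m i
          leftward  : ¬ Inner i → Own m i → Kind m i
          rightward : ¬ Inner i → Own (2 ℕ.+ m) i → Kind m i

        kind : ∀ m i → Kind m i
        kind m i with inner? i | own? m i | own? (2 ℕ.+ m) i
        ... | yes p | _     | _     = inner′ p
        ... | no ¬p | yes o | _     = leftward ¬p o
        ... | no ¬p | no _  | yes o = rightward ¬p o
        ... | no ¬p | no ¬o | no ¬o′ = alone ¬p ¬o ¬o′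

      -- A disk belonging to this rung alone, or the only disk that is not inner, is taken at once.
      -- Otherwise one disk leads to the left and one to the right: the left one is taken, unless
      -- the rung on the left is an `End` and uses it itself.
      claim-exists : ∀ b → 5 ℕ.+ b ℕ.< N → ∃ (Claim (1 ℕ.+ b))
      claim-exists b lt = go (kind (1 ℕ.+ b) (A (2 ℕ.+ b))) (kind (1 ℕ.+ b) (B (2 ℕ.+ b)))
        where
        lt′ = ℕₚ.<-trans (ℕₚ.n<1+n _) lt
        α = A (2 ℕ.+ b)
        β = B (2 ℕ.+ b)

        middle : ∀ {i i′} → Middle (2 ℕ.+ b) i i′ → Own (1 ℕ.+ b) i → Own (3 ℕ.+ b) i′ →
                 ¬ Inner i → ¬ Inner i′ → ∃ (Claim (1 ℕ.+ b))
        middle {i} {i′} m o o′ ¬p ¬p′ with end? (1 ℕ.+ b) i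
        ... | yes e = i′ , right i m o o′ ¬p′ e
        ... | no ¬e = i , left i′ m o o′ ¬p ¬e

        go : Kind (1 ℕ.+ b) α → Kind (1 ℕ.+ b) β → ∃ (Claim (1 ℕ.+ b))
        go _                (inner′ p)        = ⊥-elim (inner-upper (1 ℕ.+ b) lt p)
        go _                (alone ¬p ¬o ¬o′) = β , pure (inj₂ refl) ¬p ¬o ¬o′
        go (alone ¬p ¬o ¬o′) _                = α , pure (inj₁ refl) ¬p ¬o ¬o′
        go (inner′ p)       (leftward ¬p _)   = β , end (¬p , refl , inj₂ p)
        go (inner′ p)       (rightward ¬p _)  = β , end (¬p , refl , inj₂ p)
        go (leftward ¬p o)  (leftward ¬p′ o′) = case α Finₚ.≟ β of λ
          { (yes eq) → β , end (¬p′ , refl , inj₁ eq)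
          ; (no neq) → ⊥-elim (not-both-left b lt′ neq o o′) }
        go (rightward ¬p o) (rightward ¬p′ o′) = case α Finₚ.≟ β of λ
          { (yes eq) → β , end (¬p′ , refl , inj₁ eq)
          ; (no neq) → ⊥-elim (not-both-right (1 ℕ.+ b) lt neq o o′) }
        go (leftward ¬p o)  (rightward ¬p′ o′) = middle (inj₁ (refl , refl)) o o′ ¬p ¬p′
        go (rightward ¬p o) (leftward ¬p′ o′)  = middle (inj₂ (refl , refl)) o′ o ¬p′ ¬p

      private
        -- Most pairs of claims contradict each other by their side conditions or by `not-adjacent`.
        -- Three chains remain, and geometry excludes them: end and end; end, middle and end; end
        -- and two middles.
        consecutive : ∀ b {i} → 6 ℕ.+ b ℕ.< N → Claim (1 ℕ.+ b) i → Claim (2 ℕ.+ b) i → ⊥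
        consecutive b {i} 6+b<N c c′ = go c c′
          where
          5+b<N = ℕₚ.<-trans (ℕₚ.n<1+n _) 6+b<N
          4+b<N = ℕₚ.<-trans (ℕₚ.n<1+n _) 5+b<N

          far : ∀ {i} → Own (2 ℕ.+ b) i → Own (4 ℕ.+ b) i → ⊥
          far o o′ = neighbours-apart (1 ℕ.+ b) 5+b<N o o′ refl

          go : Claim (1 ℕ.+ b) i → Claim (2 ℕ.+ b) i → ⊥
          go (pure _ _ _ ¬o)          c′                       = ¬o (claim-own c′)
          go c@(end _)                (pure _ _ ¬o _)          = ¬o (claim-own c)
          go (end e)                  (end e′)                 = end-end (1 ℕ.+ b) 5+b<N e e′
          go (end e)                  (left _ _ _ _ _ ¬e)      = ¬e e
          go c@(end _)                (right _ _ _ o′ _ _)     = far (claim-own c) o′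
          go (left _ _ o _ _ _)       c′                       = neighbours-apart b 4+b<N o (claim-own c′) refl
          go c@(right _ _ _ _ _ _)    (pure _ _ ¬o _)          = ¬o (claim-own c)
          go (right j m o o₃ _ e)     (end e′)                 =
            end-middle-end b 5+b<N (neighbours-apart b 4+b<N o o₃) e m e′
          go (right j m o o₃ ¬p e)    (left j′ m′ o₂ o₄ _ _)   =
            end-middle-middle b 6+b<N (neighbours-apart b 4+b<N o o₃)
              (neighbours-apart (1 ℕ.+ b) 5+b<N o₂ o₄)
              (λ { refl → not-adjacent (1 ℕ.+ b) (ℕₚ.n≤1+n _) 4+b<N o o₄ })
              ¬p e m m′ o₄
          go c@(right _ _ _ _ _ _)    (right _ _ _ o′ _ _)     = far (claim-own c) o′

        claims-apart : ∀ {b b′ i} → 5 ℕ.+ b′ ℕ.< N → b ℕ.< b′ → Claim (1 ℕ.+ b) i → Claim (1 ℕ.+ b′) i → ⊥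
        claims-apart {b} {b′} lt b<b′ c c′ = [ two , one ]′ (ℕₚ.m≤n⇒m<n∨m≡n b<b′)
          where
          two : 1 ℕ.+ b ℕ.< b′ → ⊥
          two 1+b<b′ = not-adjacent (2 ℕ.+ b) (s≤s (s≤s 1+b<b′))
            (ℕₚ.≤-<-trans (ℕₚ.m≤n+m (2 ℕ.+ b′) 3) lt) (claim-own c) (claim-own c′)
          one : 1 ℕ.+ b ≡ b′ → ⊥
          one refl = consecutive b lt c c′

      claim-injective : ∀ {b b′ i} → 5 ℕ.+ b ℕ.< N → 5 ℕ.+ b′ ℕ.< N → Claim (1 ℕ.+ b) i → Claim (1 ℕ.+ b′) i → b ≡ b′
      claim-injective {b} {b′} lt lt′ c c′ with ℕₚ.<-cmp b b′
      ... | tri< b<b′ _ _ = ⊥-elim (claims-apart lt′ b<b′ c c′)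
      ... | tri≈ _ eq _   = eq
      ... | tri> _ _ b′<b = ⊥-elim (claims-apart lt b′<b c′ c)

      abstract
        -- The rung charged is 2 + b. Two rungs at the left end and four at the right end are given
        -- up, so that the local arguments have room.
        charge : ∀ {m} → 6 ℕ.+ m ≡ N → Fin m → Fin k
        charge refl b = proj₁ (claim-exists (toℕ b) (ℕₚ.m≤n⇒m≤1+n (ℕₚ.+-monoʳ-≤ 5 (Finₚ.toℕ<n b))))

        charge-claim : ∀ {m} (eq : 6 ℕ.+ m ≡ N) b → Claim (1 ℕ.+ toℕ b) (charge eq b)
        charge-claim refl b = proj₂ (claim-exists (toℕ b) (ℕₚ.m≤n⇒m≤1+n (ℕₚ.+-monoʳ-≤ 5 (Finₚ.toℕ<n b))))

        charge-injective : ∀ {m} (eq : 6 ℕ.+ m ≡ N) {b b′} → charge eq b ≡ charge eq b′ → b ≡ b′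
        charge-injective {m} eq {b} {b′} same = Finₚ.toℕ-injective
          (claim-injective (bound eq b) (bound eq b′) (charge-claim eq b)
            (subst (Claim (1 ℕ.+ toℕ b′)) (sym same) (charge-claim eq b′)))
          where
          bound : 6 ℕ.+ m ≡ N → ∀ (b : Fin m) → 5 ℕ.+ toℕ b ℕ.< N
          bound refl b = ℕₚ.m≤n⇒m≤1+n (ℕₚ.+-monoʳ-≤ 5 (Finₚ.toℕ<n b))

  -- Geometry of one wall

  inBox : Pt → Bool
  inBox (x , y) = (∣ x ∣ ℕ.≤ᵇ 50000) ∧ (∣ y ∣ ℕ.≤ᵇ 50000)

  -- Stated for arbitrary forms rather than disks, so that it also applies to the reflected upper
  -- wall.
  module Wall {k : ℕ} (N : ℕ) (F : Fin k → Form) (A B : ℕ → Fin k)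
    (Inner : Fin k → Set) (inner? : ∀ i → Dec (Inner i))
    (onU : ∀ j → j ℕ.< N → F (A j) ⊨ on (U j))
    (onL : ∀ j → j ℕ.< N → F (B j) ⊨ on (L j))
    (offU : ∀ i j → j ℕ.< N → F i ⊨ outside (U j))
    (offL : ∀ i j → j ℕ.< N → F i ⊨ outside (L j))
    (offTop : ∀ i j → j ℕ.< N → F i ⊨ outside (Top j))
    (high : ∀ i → Inner i → ∃ λ X → ∃ λ Z → h ≤ Z × F i ⊨ on (X , Z))
    (apart : ∀ {i i′} → i ≢ i′ → ∀ j → j ℕ.< N → ∀ x y → T (inBox (x , y)) →
             F i ⊨ outside (S * + j + x , y) ⊎ F i′ ⊨ outside (S * + j + x , y))
    where

    open Touching A B Inner

    own-on : ∀ {j i} → j ℕ.< N → Own j i →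
      F i ⊨ on (S * + j - tilt j , + 1) ⊎ F i ⊨ on (S * + j + tilt j , - + 1)
    own-on {j} j<N (inj₁ refl) = inj₁ (onU j j<N)
    own-on {j} j<N (inj₂ refl) = inj₂ (onL j j<N)

    private
      Row-on : Fin k → ℤ → ℕ → Set
      Row-on i y j = ∃ λ o → Small o × F i ⊨ on (S * + j + o , y)

      own-lower : ∀ {j i} → 0ℤ ≤ y-coeff (F i) → j ℕ.< N → Own j i → Row-on i (- + 1) j
      own-lower {j} {i} 0≤b j<N o = [ (λ p → - tilt j , small-neg (small-tilt j) , on-lower (F i) (S * + j - tilt j) 0≤b p)
                                    , (λ p → tilt j , small-tilt j , p) ]′ (own-on j<N o)

      own-raise : ∀ {j i} → y-coeff (F i) ≤ 0ℤ → j ℕ.< N → Own j i → Row-on i (+ 1) j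
      own-raise {j} {i} b≤0 j<N o = [ (λ p → - tilt j , small-neg (small-tilt j) , p)
                                    , (λ p → tilt j , small-tilt j , on-raise (F i) (S * + j + tilt j) b≤0 p) ]′ (own-on j<N o)

      -- Both contacts can be moved to the same row, the one on the side of the centre, and there
      -- the point of rung 1 + j lies between them.
      not-adjacent′ : ∀ {i} j m → 2 ℕ.+ j ℕ.+ m ℕ.< N → Own j i → Own (2 ℕ.+ j ℕ.+ m) i → ⊥
      not-adjacent′ {i} j m lt o o′ = [ lower , raise ]′ (ℤₚ.≤-total 0ℤ (y-coeff (F i)))
        where
        1+j<N : 1 ℕ.+ j ℕ.< N
        1+j<N = ℕₚ.≤-<-trans (ℕₚ.≤-trans (ℕₚ.n≤1+n _) (ℕₚ.m≤m+n (2 ℕ.+ j) m)) lt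
        j<N = ℕₚ.<-trans (ℕₚ.n<1+n j) 1+j<N
        lower : 0ℤ ≤ y-coeff (F i) → ⊥
        lower 0≤b =
          let o₀ , s₀ , p₀ = own-lower 0≤b j<N o
              o₂ , s₂ , p₂ = own-lower 0≤b lt o′
          in apart-in-row (F i) j m o₀ (tilt (1 ℕ.+ j)) o₂ (- + 1) s₀ (small-tilt (1 ℕ.+ j)) s₂ p₀
             (offL i (1 ℕ.+ j) 1+j<N) p₂
        raise : y-coeff (F i) ≤ 0ℤ → ⊥
        raise b≤0 =
          let o₀ , s₀ , p₀ = own-raise b≤0 j<N o
              o₂ , s₂ , p₂ = own-raise b≤0 lt o′
          in apart-in-row (F i) j m o₀ (- tilt (1 ℕ.+ j)) o₂ (+ 1) s₀
             (small-neg (small-tilt (1 ℕ.+ j))) s₂ p₀ (offU i (1 ℕ.+ j) 1+j<N) p₂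

    not-adjacent : ∀ {i} j {j′} → 2 ℕ.+ j ℕ.≤ j′ → j′ ℕ.< N → Own j i → Own j′ i → ⊥
    not-adjacent j 2+j≤j′ j′<N o o′ = after (ℕₚ.m≤n⇒∃[o]m+o≡n 2+j≤j′) j′<N o o′
      where
      after : ∀ {i j j′} → (∃ λ m → 2 ℕ.+ j ℕ.+ m ≡ j′) → j′ ℕ.< N → Own j i → Own j′ i → ⊥
      after (m , refl) = not-adjacent′ _ m

    G : ℕ → Fin k → Form
    G b i = shift (S * + b) (F i)

    inner≢ : ∀ {a i} → Inner a → ¬ Inner i → a ≢ i
    inner≢ inner ¬inner refl = ¬inner inner

    module Base (b : ℕ) (b+4<N : 4 ℕ.+ b ℕ.< N) where

      in-wall : ∀ (o : Fin 5) → toℕ o ℕ.+ b ℕ.< N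
      in-wall o = ℕₚ.≤-<-trans (ℕₚ.+-monoˡ-≤ b (ℕₚ.≤-pred (Finₚ.toℕ<n o))) b+4<N

      private
        window-tilt : ∀ o → lookup (window b) o ≡ tilt (toℕ o ℕ.+ b)
        window-tilt 0F = refl
        window-tilt 1F = refl
        window-tilt 2F = refl
        window-tilt 3F = refl
        window-tilt 4F = refl

        split : ∀ n b a → + 10000 * (n + b) + a ≡ + 10000 * b + (+ 10000 * n + a)
        split = ℤR.solve-∀

        U-x : ∀ o → S * + (toℕ o ℕ.+ b) - tilt (toℕ o ℕ.+ b) ≡ S * + b + (S * + toℕ o - lookup (window b) o)
        U-x o = trans (cong (λ a → S * + (toℕ o ℕ.+ b) - a) (sym (window-tilt o)))
                      (split (+ toℕ o) (+ b) (- lookup (window b) o))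

        L-x : ∀ o → S * + (toℕ o ℕ.+ b) + tilt (toℕ o ℕ.+ b) ≡ S * + b + (S * + toℕ o + lookup (window b) o)
        L-x o = trans (cong (λ a → S * + (toℕ o ℕ.+ b) + a) (sym (window-tilt o)))
                      (split (+ toℕ o) (+ b) (lookup (window b) o))

      on-u : ∀ o {i} → A (toℕ o ℕ.+ b) ≡ i → G b i ⊨ on (u o (window b))
      on-u o refl = on-shift (S * + b) (F _) _ _ (+ 1) (U-x o) (onU (toℕ o ℕ.+ b) (in-wall o))

      on-l : ∀ o {i} → B (toℕ o ℕ.+ b) ≡ i → G b i ⊨ on (l o (window b))
      on-l o refl = on-shift (S * + b) (F _) _ _ (- + 1) (L-x o) (onL (toℕ o ℕ.+ b) (in-wall o))

      off-u : ∀ o i → G b i ⊨ outside (u o (window b))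
      off-u o i = outside-shift (S * + b) (F i) _ _ (+ 1) (U-x o) (offU i (toℕ o ℕ.+ b) (in-wall o))

      off-l : ∀ o i → G b i ⊨ outside (l o (window b))
      off-l o i = outside-shift (S * + b) (F i) _ _ (- + 1) (L-x o) (offL i (toℕ o ℕ.+ b) (in-wall o))

      off-t : ∀ o i → G b i ⊨ outside (t o (window b))
      off-t o i = outside-shift (S * + b) (F i) _ _ (+ 2 * h - + 1) (U-x o) (offTop i (toℕ o ℕ.+ b) (in-wall o))

      separated : ∀ (z : Vec ℤ 5 → Pt)
        {_ : T (inBox (z (window 0)))} {_ : T (inBox (z (window 1)))}
        {_ : T (inBox (z (window 2)))} {_ : T (inBox (z (window 3)))} →
        ∀ {i i′} → i ≢ i′ → G b i ⊨ outside (z (window b)) ⊎ G b i′ ⊨ outside (z (window b))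
      separated z {t₀} {t₁} {t₂} {t₃} {i} {i′} i≢i′ =
        [ (λ p → inj₁ (outside-shift (S * + b) (F i) _ x y refl p))
        , (λ p → inj₂ (outside-shift (S * + b) (F i′) _ x y refl p)) ]′
        (apart i≢i′ b (in-wall 0F) x y
          (window-elim (λ w → T (inBox (z w))) t₀ t₁ t₂ t₃ b))
        where
        x = proj₁ (z (window b))
        y = proj₂ (z (window b))

      own-low : ∀ {i} (o : Fin 5) → Inner i → Own (suc (toℕ o) ℕ.+ b) i → suc (suc (toℕ o)) ℕ.+ b ℕ.< N → G b i ⊨ low
      own-low {i} o inner own lt = subst (0ℤ ≤_) (sym (shift-low (S * + b) (F i))) ([ upper , lower ]′ own)
        where
        j = toℕ o ℕ.+ b
        1+j<N = ℕₚ.<-trans (ℕₚ.n<1+n _) lt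
        j<N = ℕₚ.<-trans (ℕₚ.n<1+n _) 1+j<N
        X = proj₁ (high i inner)
        Z = proj₁ (proj₂ (high i inner))
        h≤Z = proj₁ (proj₂ (proj₂ (high i inner)))
        touch = proj₂ (proj₂ (proj₂ (high i inner)))
        upper : A (1 ℕ.+ j) ≡ i → F i ⊨ low
        upper eq = low-bound (F i) j (- tilt j) (- tilt (1 ℕ.+ j)) (- tilt (2 ℕ.+ j)) (+ 1) X Z
          ℤₚ.≤-refl -≤+ h≤Z
          (small-neg (small-tilt j)) (small-neg (small-tilt (1 ℕ.+ j))) (small-neg (small-tilt (2 ℕ.+ j)))
          (offU i j j<N) (offU i (1 ℕ.+ j) 1+j<N)
          (subst (λ i → F i ⊨ on (U (1 ℕ.+ j))) eq (onU (1 ℕ.+ j) 1+j<N))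
          (offU i (2 ℕ.+ j) lt) touch
        lower : B (1 ℕ.+ j) ≡ i → F i ⊨ low
        lower eq = low-bound (F i) j (tilt j) (tilt (1 ℕ.+ j)) (tilt (2 ℕ.+ j)) (- + 1) X Z
          -≤+ ℤₚ.≤-refl h≤Z
          (small-tilt j) (small-tilt (1 ℕ.+ j)) (small-tilt (2 ℕ.+ j))
          (offL i j j<N) (offL i (1 ℕ.+ j) 1+j<N)
          (subst (λ i → F i ⊨ on (L (1 ℕ.+ j))) eq (onL (1 ℕ.+ j) 1+j<N))
          (offL i (2 ℕ.+ j) lt) touch

      no-fall : ∀ {i} → A (1 ℕ.+ b) ≡ i → B (2 ℕ.+ b) ≡ i → ⊥
      no-fall {i} a₁ b₂ = absurd no-descent b (G b i) (on-u 1F a₁ ∷ on-l 2F b₂ ∷ off-l 1F i ∷ off-u 2F i ∷ [])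

      inner-upper : ¬ Inner (B (1 ℕ.+ b))
      inner-upper inner = absurd inner-not-l b (G b (B (1 ℕ.+ b)))
        (on-l 1F refl ∷ own-low 0F inner (inj₂ refl) (in-wall 2F) ∷ off-u 1F (B (1 ℕ.+ b)) ∷ off-u 2F (B (1 ℕ.+ b)) ∷ [])

      -- An inner disk above a rung leaves only steep disks below it.
      out-right-of-1 : ∀ {i} → Inner (A (1 ℕ.+ b)) → ¬ Inner i → G b i ⊨ outside (right-of-1 (window b))
      out-right-of-1 {i} inner ¬inner = [ (λ p → ⊥-elim (absurd inner-right b (G b (A (1 ℕ.+ b)))
          (on-u 1F refl ∷ own-low 0F inner (inj₁ refl) (in-wall 2F) ∷ p ∷ off-u 0F (A (1 ℕ.+ b)) ∷ []))) , (λ p → p) ]′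
        (separated right-of-1 (inner≢ inner ¬inner))

      out-left-of-3 : ∀ {i} → Inner (A (3 ℕ.+ b)) → ¬ Inner i → G b i ⊨ outside (left-of-3 (window b))
      out-left-of-3 {i} inner ¬inner = [ (λ p → ⊥-elim (absurd inner-left b (G b (A (3 ℕ.+ b)))
          (on-u 3F refl ∷ own-low 2F inner (inj₁ refl) (in-wall 4F) ∷ p ∷ off-u 4F (A (3 ℕ.+ b)) ∷ []))) , (λ p → p) ]′
        (separated left-of-3 (inner≢ inner ¬inner))

      -- An ascending disk would contain `right-of-1`, which the inner disk already contains.
      steep : ∀ {i} → Inner (A (1 ℕ.+ b)) → ¬ Inner i → B (1 ℕ.+ b) ≡ i → A (2 ℕ.+ b) ≡ i → ⊥
      steep {i} inner ¬inner b₁ a₂ = absurd ascent-right b (G b i)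
        (on-l 1F b₁ ∷ on-u 2F a₂ ∷ out-right-of-1 inner ¬inner ∷ off-l 2F i ∷ [])

      stacked : ∀ {i i′} → i ≢ i′ → A (1 ℕ.+ b) ≡ i → A (2 ℕ.+ b) ≡ i →
                B (1 ℕ.+ b) ≡ i′ → B (2 ℕ.+ b) ≡ i′ → ⊥
      stacked {i} {i′} i≢i′ a₁ a₂ b₁ b₂ =
        [ (λ p → absurd upper-between b (G b i) (on-u 1F a₁ ∷ on-u 2F a₂ ∷ p ∷ off-t 1F i ∷ []))
        , (λ p → absurd lower-between b (G b i′) (on-l 1F b₁ ∷ on-l 2F b₂ ∷ p ∷ off-u 1F i′ ∷ [])) ]′
        (separated between i≢i′)

    -- Both lower points belong to `i`. An upper point of `i` is excluded by `no-fall` or `steep`, a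
    -- common inner disk above by `stacked`, and two inner disks meet at `between-high`.
    end-end : ∀ b {i} → 4 ℕ.+ b ℕ.< N → End (1 ℕ.+ b) i → End (2 ℕ.+ b) i → ⊥
    end-end b {i} lt (¬inner , b₁ , e₁) (_ , b₂ , e₂) = go e₁ e₂
      where
      open Base b lt
      both : Inner (A (1 ℕ.+ b)) → Inner (A (2 ℕ.+ b)) → Dec (A (1 ℕ.+ b) ≡ A (2 ℕ.+ b)) → ⊥
      both inner₁ inner₂ (yes eq) = stacked (λ { refl → ¬inner inner₁ }) refl (sym eq) b₁ b₂
      both inner₁ inner₂ (no neq) =
        [ (λ p → absurd inner-right-high b (G b (A (1 ℕ.+ b)))
            (on-u 1F refl ∷ own-low 0F inner₁ (inj₁ refl) (in-wall 2F) ∷ p ∷ off-u 0F (A (1 ℕ.+ b)) ∷ []))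
        , (λ p → absurd inner-left-high b (G b (A (2 ℕ.+ b)))
            (on-u 2F refl ∷ own-low 1F inner₂ (inj₁ refl) (in-wall 3F) ∷ p ∷ off-l 2F (A (2 ℕ.+ b)) ∷ [])) ]′
        (separated between-high neq)
      go : A (1 ℕ.+ b) ≡ i ⊎ Inner (A (1 ℕ.+ b)) → A (2 ℕ.+ b) ≡ i ⊎ Inner (A (2 ℕ.+ b)) → ⊥
      go (inj₁ a₁)     _             = no-fall a₁ b₂
      go (inj₂ inner₁) (inj₁ a₂)     = steep inner₁ ¬inner b₁ a₂
      go (inj₂ inner₁) (inj₂ inner₂) = both inner₁ inner₂ (A (1 ℕ.+ b) Finₚ.≟ A (2 ℕ.+ b))

    end-middle-end : ∀ b {i i′} → 5 ℕ.+ b ℕ.< N → i ≢ i′ →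
      End (1 ℕ.+ b) i → Middle (2 ℕ.+ b) i i′ → End (3 ℕ.+ b) i′ → ⊥
    end-middle-end b {i} {i′} lt i≢i′ (¬inner , b₁ , e₁) m (¬inner′ , b₃ , e₃) = go m e₁ e₃
      where
      open Base b (ℕₚ.<-trans (ℕₚ.n<1+n _) lt)
      go : Middle (2 ℕ.+ b) i i′ → A (1 ℕ.+ b) ≡ i ⊎ Inner (A (1 ℕ.+ b)) →
           A (3 ℕ.+ b) ≡ i′ ⊎ Inner (A (3 ℕ.+ b)) → ⊥
      go (inj₂ (a₂ , _)) _ _ = Base.no-fall (1 ℕ.+ b) lt a₂ b₃
      go (inj₁ (a₂ , b₂)) (inj₂ inner₁) _ = steep inner₁ ¬inner b₁ a₂
      -- Both slopes at rung 2 are dictated by full rungs whose tilts differ.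
      go (inj₁ (a₂ , b₂)) (inj₁ a₁) (inj₁ a₃) =
        [ (λ p → absurd full-right-at-2 b (G b i)
            (on-u 1F a₁ ∷ on-l 1F b₁ ∷ on-u 2F a₂ ∷ p ∷ off-u 1F i ∷ off-l 1F i ∷ []))
        , (λ p → absurd full-left-at-2 b (G b i′)
            (on-l 2F b₂ ∷ on-u 3F a₃ ∷ on-l 3F b₃ ∷ p ∷ off-u 3F i′ ∷ off-l 3F i′ ∷ [])) ]′
        (separated at-2 i≢i′)
      -- Here the inner disk above rung 3 presses `i′` down, back under rung 2 and into `i`.
      go (inj₁ (a₂ , b₂)) (inj₁ a₁) (inj₂ inner₃) =
        [ (λ p → absurd full-right-at-2′ b (G b i) (on-l 1F b₁ ∷ on-u 2F a₂ ∷ p ∷ off-u 1F i ∷ []))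
        , (λ p → absurd lower-at-2′ b (G b i′) (on-l 2F b₂ ∷ on-l 3F b₃ ∷ out-left-of-3 inner₃ ¬inner′ ∷ p ∷ [])) ]′
        (separated at-2′ i≢i′)

    end-middle-middle : ∀ b {i i′ i″} → 6 ℕ.+ b ℕ.< N → i ≢ i′ → i′ ≢ i″ → i ≢ i″ → ¬ Inner i′ →
      End (1 ℕ.+ b) i → Middle (2 ℕ.+ b) i i′ → Middle (3 ℕ.+ b) i′ i″ → Own (4 ℕ.+ b) i″ → ⊥
    end-middle-middle b {i} {i′} {i″} lt i≢i′ i′≢i″ i≢i″ ¬inner′ (¬inner , b₁ , e₁) m₂ m₃ o₄ = go m₂ m₃ e₁
      where
      5+b<N = ℕₚ.<-trans (ℕₚ.n<1+n _) lt
      open Base b (ℕₚ.<-trans (ℕₚ.n<1+n _) 5+b<N)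

      -- i′ is nearly opposite to i at rung 2, and i″ to i′ at rung 3, so that i
      -- and i″ lie on the same side of the wall and meet.
      out-at-2″ : A (1 ℕ.+ b) ≡ i → A (2 ℕ.+ b) ≡ i → G b i′ ⊨ outside (at-2″ (window b))
      out-at-2″ a₁ a₂ = [ (λ p → ⊥-elim (absurd full-right-at-2″ b (G b i)
          (on-u 1F a₁ ∷ on-u 2F a₂ ∷ p ∷ off-l 1F i ∷ [])))
                    , (λ p → p) ]′
        (separated at-2″ i≢i′)

      opposite : A (1 ℕ.+ b) ≡ i → A (2 ℕ.+ b) ≡ i →
        (G b i″ ⊨ outside (at-3 (window b)) → G b i″ ⊨ outside (between-2-3 (window b)) → ⊥) →
        (G b i′ ⊨ outside (at-3 (window b)) → ⊥) → ⊥
      opposite a₁ a₂ third second = [ second , meet ]′ (separated at-3 i′≢i″)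
        where
        meet : G b i″ ⊨ outside (at-3 (window b)) → ⊥
        meet p = [ (λ q → absurd full-right-between b (G b i) (on-u 1F a₁ ∷ on-u 2F a₂ ∷ q ∷ off-l 1F i ∷ []))
                    , third p ]′ (separated between-2-3 i≢i″)

      go : Middle (2 ℕ.+ b) i i′ → Middle (3 ℕ.+ b) i′ i″ → A (1 ℕ.+ b) ≡ i ⊎ Inner (A (1 ℕ.+ b)) → ⊥
      go (inj₁ (a₂ , _)) _ (inj₂ inner₁) = steep inner₁ ¬inner b₁ a₂
      go (inj₁ (a₂ , b₂)) (inj₁ (a₃ , b₃)) (inj₁ a₁) = opposite a₁ a₂
        (λ p q → [ (λ a₄ → absurd ascent-between-2-3 b (G b i″) (on-l 3F b₃ ∷ on-u 4F a₄ ∷ p ∷ q ∷ []))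
                 , (λ b₄ → absurd lower-between-2-3 b (G b i″) (on-l 3F b₃ ∷ on-l 4F b₄ ∷ p ∷ q ∷ [])) ]′ o₄)
        (λ p → absurd ascent-at-3 b (G b i′) (on-l 2F b₂ ∷ on-u 3F a₃ ∷ out-at-2″ a₁ a₂ ∷ p ∷ []))
      go (inj₁ (a₂ , b₂)) (inj₂ (a₃ , b₃)) (inj₁ a₁) = opposite a₁ a₂
        (λ p q → [ (λ a₄ → absurd upper-between-2-3 b (G b i″) (on-u 3F a₃ ∷ on-u 4F a₄ ∷ p ∷ q ∷ []))
                 , Base.no-fall (2 ℕ.+ b) lt a₃ ]′ o₄)
        (λ p → absurd lower-at-3 b (G b i′) (on-l 2F b₂ ∷ on-l 3F b₃ ∷ out-at-2″ a₁ a₂ ∷ p ∷ []))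
      go (inj₂ (a₂ , b₂)) (inj₂ (_ , b₃)) _ = Base.no-fall (1 ℕ.+ b) 5+b<N a₂ b₃
      go (inj₂ (a₂ , b₂)) (inj₁ (a₃ , _)) (inj₁ a₁) = no-fall a₁ b₂
      -- The inner disk presses `i` down over `low-2`; avoiding that point, `i′` becomes so high
      -- that it meets the inner disk at `above-2`.
      go (inj₂ (a₂ , b₂)) (inj₁ (a₃ , _)) (inj₂ inner₁) =
        [ (λ p → absurd lower-low-2 b (G b i)
            (on-l 1F b₁ ∷ on-l 2F b₂ ∷ out-right-of-1 inner₁ ¬inner ∷ p ∷ off-u 1F i ∷ []))
        , (λ p → [ (λ q → absurd inner-above-2 b (G b (A (1 ℕ.+ b)))
                     (on-u 1F refl ∷ own-low 0F inner₁ (inj₁ refl) (in-wall 2F) ∷ q ∷ off-u 0F (A (1 ℕ.+ b)) ∷ []))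
                 , (λ q → absurd upper-above-2 b (G b i′) (on-u 2F a₂ ∷ on-u 3F a₃ ∷ p ∷ q ∷ [])) ]′
                 (separated above-2 (inner≢ inner₁ ¬inner′))) ]′
        (separated low-2 i≢i′)

    inner-upper : ∀ b → 4 ℕ.+ b ℕ.< N → ¬ Inner (B (1 ℕ.+ b))
    inner-upper b lt = Base.inner-upper b lt

    not-both-left : ∀ b → 4 ℕ.+ b ℕ.< N → A (2 ℕ.+ b) ≢ B (2 ℕ.+ b) →
      Own (1 ℕ.+ b) (A (2 ℕ.+ b)) → Own (1 ℕ.+ b) (B (2 ℕ.+ b)) → ⊥
    not-both-left b lt a≢b _         (inj₁ a′) = Base.no-fall b lt a′ refl
    not-both-left b lt a≢b (inj₂ a)  (inj₂ b′) = a≢b (trans (sym a) b′)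
    not-both-left b lt a≢b (inj₁ a)  (inj₂ b′) = Base.stacked b lt a≢b a refl b′ refl

    not-both-right : ∀ b → 4 ℕ.+ b ℕ.< N → A (1 ℕ.+ b) ≢ B (1 ℕ.+ b) →
      Own (2 ℕ.+ b) (A (1 ℕ.+ b)) → Own (2 ℕ.+ b) (B (1 ℕ.+ b)) → ⊥
    not-both-right b lt a≢b (inj₂ a)  _         = Base.no-fall b lt refl a
    not-both-right b lt a≢b (inj₁ a)  (inj₁ b′) = a≢b (trans (sym a) b′)
    not-both-right b lt a≢b (inj₁ a)  (inj₂ b′) = Base.stacked b lt a≢b refl a refl b′

-- Integer forms approximating real disks

module Approximations where

  open Forms using (Form; form; _∙_; _⊨_; outside; on)
  open Form
  open D using (ℝ; seq; cauchy; Disk; centre; radius; InInterior; OnBoundary; dist²; Point)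
  open import Data.Rational.Base
  open ℚS.+-*-Solver using (solve; _:=_; _:+_; _:*_; _:-_; :-_; con)

  fromℤ-+ : ∀ i j → fromℤ (i ℤ.+ j) ≡ fromℤ i + fromℤ j
  fromℤ-+ i j = ℚₚ.toℚᵘ-injective (ℚᵘₚ.≃-trans (ℚᵘ.*≡* (eq i j))
    (ℚᵘₚ.≃-sym (ℚₚ.toℚᵘ-homo-+ (fromℤ i) (fromℤ j))))
    where
    eq : ∀ i j → (i ℤ.+ j) ℤ.* + 1 ≡ (i ℤ.* + 1 ℤ.+ j ℤ.* + 1) ℤ.* + 1
    eq = ℤR.solve-∀

  fromℤ-* : ∀ i j → fromℤ (i ℤ.* j) ≡ fromℤ i * fromℤ j
  fromℤ-* i j = ℚₚ.toℚᵘ-injective (ℚᵘₚ.≃-sym (ℚₚ.toℚᵘ-homo-* (fromℤ i) (fromℤ j)))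

  fromℤ-neg : ∀ i → fromℤ (ℤ.- i) ≡ - fromℤ i
  fromℤ-neg (+ 0)       = refl
  fromℤ-neg (+ (suc n)) = refl
  fromℤ-neg -[1+ n ]    = refl

  fromℤ-mono-≤ : ∀ {i j} → i ℤ.≤ j → fromℤ i ≤ fromℤ j
  fromℤ-mono-≤ i≤j = *≤* (ℤₚ.*-monoʳ-≤-nonNeg (+ 1) i≤j)

  fromℤ-cancel-≤ : ∀ {i j} → fromℤ i ≤ fromℤ j → i ℤ.≤ j
  fromℤ-cancel-≤ {i} {j} p = subst₂ ℤ._≤_ (ℤₚ.*-identityʳ i) (ℤₚ.*-identityʳ j) (ℚₚ.drop-*≤* p)

  fromℤ-mono-< : ∀ {i j} → i ℤ.< j → fromℤ i < fromℤ j
  fromℤ-mono-< i<j = *<* (ℤₚ.*-monoʳ-<-pos (+ 1) i<j)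

  numerator-denominator : ∀ q → fromℤ (↥ q) ≡ q * fromℤ (↧ q)
  numerator-denominator q = ℚₚ.toℚᵘ-injective (ℚᵘₚ.≃-trans (eq q)
    (ℚᵘₚ.≃-sym (ℚₚ.toℚᵘ-homo-* q (fromℤ (↧ q)))))
    where
    eq : ∀ q → ℚ.toℚᵘ (fromℤ (↥ q)) ℚᵘ.≃ ℚ.toℚᵘ q ℚᵘ.* ℚ.toℚᵘ (fromℤ (↧ q))
    eq q@record{} = ℚᵘ.*≡* (lemma (↥ q) (↧ q))
      where
      lemma : ∀ n d → n ℤ.* (d ℤ.* + 1) ≡ n ℤ.* d ℤ.* + 1
      lemma = ℤR.solve-∀

  -- Clearing denominators in x² + y² + α x + β y + γ.
  clear : ℚ → ℚ → ℚ → Form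
  clear α β γ = form (↧ α ℤ.* ↧ β ℤ.* ↧ γ) (↥ α ℤ.* ↧ β ℤ.* ↧ γ) (↥ β ℤ.* ↧ α ℤ.* ↧ γ) (↥ γ ℤ.* ↧ α ℤ.* ↧ β)
    (scale-positive α β γ)
    where
    scale-positive : ∀ α β γ → 0ℤ ℤ.< ↧ α ℤ.* ↧ β ℤ.* ↧ γ
    scale-positive record{} record{} record{} = ℤ.+<+ (ℕ.s≤s ℕ.z≤n)

  value : ℚ → ℚ → ℚ → ℤ → ℤ → ℚ
  value α β γ x y = fromℤ x * fromℤ x + fromℤ y * fromℤ y + α * fromℤ x + β * fromℤ y + γ

  module _ (α β γ : ℚ) (x y : ℤ) where

    private
      X = fromℤ x
      Y = fromℤ y
      a = fromℤ (↧ α)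
      b = fromℤ (↧ β)
      c = fromℤ (↧ γ)

      row-homo : ∀ e x y w d p q r →
        fromℤ (e ℤ.* d ℤ.+ x ℤ.* p ℤ.+ y ℤ.* q ℤ.+ w ℤ.* r)
        ≡ fromℤ e * fromℤ d + fromℤ x * fromℤ p + fromℤ y * fromℤ q + fromℤ w * fromℤ r
      row-homo e x y w d p q r =
        trans (fromℤ-+ (e ℤ.* d ℤ.+ x ℤ.* p ℤ.+ y ℤ.* q) (w ℤ.* r)) (cong₂ _+_
          (trans (fromℤ-+ (e ℤ.* d ℤ.+ x ℤ.* p) (y ℤ.* q)) (cong₂ _+_
            (trans (fromℤ-+ (e ℤ.* d) (x ℤ.* p)) (cong₂ _+_ (fromℤ-* e d) (fromℤ-* x p)))
            (fromℤ-* y q)))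
          (fromℤ-* w r))

      triple : ∀ i j k → fromℤ (i ℤ.* j ℤ.* k) ≡ fromℤ i * fromℤ j * fromℤ k
      triple i j k = trans (fromℤ-* (i ℤ.* j) k) (cong (_* fromℤ k) (fromℤ-* i j))

      norm : fromℤ (x ℤ.* x ℤ.+ y ℤ.* y) ≡ X * X + Y * Y
      norm = trans (fromℤ-+ (x ℤ.* x) (y ℤ.* y)) (cong₂ _+_ (fromℤ-* x x) (fromℤ-* y y))

    clear-scale : fromℤ (scale (clear α β γ)) ≡ a * b * c
    clear-scale = triple (↧ α) (↧ β) (↧ γ)

    private
      x-coeff-eq : fromℤ (x-coeff (clear α β γ)) ≡ α * a * b * c
      x-coeff-eq = trans (triple (↥ α) (↧ β) (↧ γ)) (cong (λ p → p * b * c) (numerator-denominator α))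
      y-coeff-eq : fromℤ (y-coeff (clear α β γ)) ≡ β * b * a * c
      y-coeff-eq = trans (triple (↥ β) (↧ α) (↧ γ)) (cong (λ p → p * a * c) (numerator-denominator β))
      const-eq : fromℤ (const (clear α β γ)) ≡ γ * c * a * b
      const-eq = trans (triple (↥ γ) (↧ α) (↧ β)) (cong (λ p → p * a * b) (numerator-denominator γ))

    private
      row-clear : ∀ e x y w → fromℤ ((e , x , y , w) ∙ clear α β γ) ≡
        fromℤ e * (a * b * c) + fromℤ x * (α * a * b * c) + fromℤ y * (β * b * a * c) + fromℤ w * (γ * c * a * b)
      row-clear e x y w = trans
        (row-homo e x y w (scale (clear α β γ)) (x-coeff (clear α β γ)) (y-coeff (clear α β γ)) (const (clear α β γ)))
        (cong₂ _+_ (cong₂ _+_ (cong₂ _+_ (cong (fromℤ e *_) clear-scale) (cong (fromℤ x *_) x-coeff-eq))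
          (cong (fromℤ y *_) y-coeff-eq)) (cong (fromℤ w *_) const-eq))

    clear-outside : fromℤ (outside (x , y) ∙ clear α β γ) ≡ fromℤ (scale (clear α β γ)) * (value α β γ x y + 1ℚ)
    clear-outside = trans (row-clear (x ℤ.* x ℤ.+ y ℤ.* y ℤ.+ + 1) x y (+ 1))
      (trans (cong (λ e → e * (a * b * c) + X * (α * a * b * c) + Y * (β * b * a * c) + 1ℚ * (γ * c * a * b))
        (trans (fromℤ-+ (x ℤ.* x ℤ.+ y ℤ.* y) (+ 1)) (cong (_+ 1ℚ) norm)))
      (trans (solve 8 (λ X Y α β γ a b c →
          (X :* X :+ Y :* Y :+ con 1ℚ) :* (a :* b :* c) :+ X :* (α :* a :* b :* c) :+ Y :* (β :* b :* a :* c)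
          :+ con 1ℚ :* (γ :* c :* a :* b)
          := a :* b :* c :* (X :* X :+ Y :* Y :+ α :* X :+ β :* Y :+ γ :+ con 1ℚ)) refl X Y α β γ a b c)
        (cong (_* (value α β γ x y + 1ℚ)) (sym clear-scale))))

    clear-on : fromℤ (on (x , y) ∙ clear α β γ) ≡ fromℤ (scale (clear α β γ)) * (1ℚ - value α β γ x y)
    clear-on = trans (row-clear (+ 1 ℤ.- (x ℤ.* x ℤ.+ y ℤ.* y)) (ℤ.- x) (ℤ.- y) (ℤ.- + 1))
      (trans (cong₂ (λ e p → e * (a * b * c) + p * (α * a * b * c) + fromℤ (ℤ.- y) * (β * b * a * c)
                        + - 1ℚ * (γ * c * a * b))
        (trans (fromℤ-+ (+ 1) (ℤ.- (x ℤ.* x ℤ.+ y ℤ.* y)))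
               (cong (λ n → 1ℚ + n) (trans (fromℤ-neg (x ℤ.* x ℤ.+ y ℤ.* y)) (cong -_ norm)))) (fromℤ-neg x))
      (trans (cong (λ q → (1ℚ - (X * X + Y * Y)) * (a * b * c) + - X * (α * a * b * c)
                         + q * (β * b * a * c) + - 1ℚ * (γ * c * a * b))
        (fromℤ-neg y))
      (trans (solve 8 (λ X Y α β γ a b c →
          (con 1ℚ :- (X :* X :+ Y :* Y)) :* (a :* b :* c) :+ (:- X) :* (α :* a :* b :* c)
          :+ (:- Y) :* (β :* b :* a :* c) :+ con (- 1ℚ) :* (γ :* c :* a :* b)
          := a :* b :* c :* (con 1ℚ :- (X :* X :+ Y :* Y :+ α :* X :+ β :* Y :+ γ))) refl X Y α β γ a b c)
        (cong (_* (1ℚ - value α β γ x y)) (sym clear-scale)))))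

  instance
    scale-pos : ∀ {f} → Positive (fromℤ (scale f))
    scale-pos {f} = positive (fromℤ-mono-< (scale>0 f))

  outside-negative : ∀ α β γ x y → outside (x , y) ∙ clear α β γ ℤ.< 0ℤ → value α β γ x y + 1ℚ < 0ℚ
  outside-negative α β γ x y neg = ℚₚ.*-cancelˡ-<-nonNeg s {{ℚₚ.pos⇒nonNeg s {{scale-pos {clear α β γ}}}}}
    (subst₂ _<_ (clear-outside α β γ x y) (sym (ℚₚ.*-zeroʳ s)) (fromℤ-mono-< neg))
    where s = fromℤ (scale (clear α β γ))

  on-nonneg : ∀ α β γ x y → value α β γ x y ≤ 1ℚ → clear α β γ ⊨ on (x , y)
  on-nonneg α β γ x y v≤1 = fromℤ-cancel-≤ (subst₂ _≤_ (ℚₚ.*-zeroʳ s) (sym (clear-on α β γ x y))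
    (ℚₚ.*-monoˡ-≤-nonNeg s {{ℚₚ.pos⇒nonNeg s {{scale-pos {clear α β γ}}}}} 0≤1-v))
    where
    s = fromℤ (scale (clear α β γ))
    v = value α β γ x y
    0≤1-v : 0ℚ ≤ 1ℚ - v
    0≤1-v = subst (_≤ 1ℚ - v) (ℚₚ.+-inverseʳ v) (ℚₚ.+-monoˡ-≤ (- v) v≤1)

  point : ℤ → ℤ → Point
  point x y = D.fromℚ (fromℤ x) , D.fromℚ (fromℤ y)

  ¼ ¾ : ℚ
  ¼ = + 1 / 4
  ¾ = + 3 / 4

  module _ (α β γ : ℝ) (M : ℕ) where

    private
      valueₙ : ℕ → ℤ → ℤ → ℚ
      valueₙ n = value (seq α n) (seq β n) (seq γ n)

      μ = fromℤ (+ suc M)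
      -- Two coefficients are multiplied by coordinates up to `M` and the third by 1; each
      -- contributes at most ¼ to the total error ¾.
      δ = 1/ μ * ¼

      μδ : μ * δ ≡ ¼
      μδ = trans (sym (ℚₚ.*-assoc μ (1/ μ) ¼)) (trans (cong (_* ¼) (ℚₚ.*-inverseʳ μ)) (ℚₚ.*-identityˡ ¼))

      0<δ : 0ℚ < δ
      0<δ = ℚₚ.positive⁻¹ δ {{ℚₚ.pos*pos⇒pos (1/ μ) ¼}}

      ∣x∣≤μ : ∀ x → ℤ.∣ x ∣ ℕ.≤ M → ∣ fromℤ x ∣ ≤ μ
      ∣x∣≤μ x x≤M = subst (_≤ μ) (abs x) (fromℤ-mono-≤ (ℤ.+≤+ (ℕₚ.m≤n⇒m≤1+n x≤M)))
        where
        abs : ∀ x → fromℤ (+ ℤ.∣ x ∣) ≡ ∣ fromℤ x ∣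
        abs (+ 0)       = refl
        abs (+ (suc n)) = refl
        abs -[1+ n ]    = refl

      term : ∀ d x → ∣ d ∣ < δ → ℤ.∣ x ∣ ℕ.≤ M → ∣ d * fromℤ x ∣ ≤ ¼
      term d x d<δ x≤M = begin
        ∣ d * fromℤ x ∣     ≡⟨ ℚₚ.∣p*q∣≡∣p∣*∣q∣ d (fromℤ x) ⟩
        ∣ d ∣ * ∣ fromℤ x ∣ ≤⟨ ℚₚ.*-monoʳ-≤-nonNeg ∣ fromℤ x ∣ {{nonNegative (ℚₚ.0≤∣p∣ (fromℤ x))}} (ℚₚ.<⇒≤ d<δ) ⟩
        δ * ∣ fromℤ x ∣     ≤⟨ ℚₚ.*-monoˡ-≤-nonNeg δ {{ℚₚ.pos⇒nonNeg δ {{positive 0<δ}}}} (∣x∣≤μ x x≤M) ⟩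
        δ * μ               ≡⟨ trans (ℚₚ.*-comm δ μ) μδ ⟩
        ¼                   ∎
        where open ℚₚ.≤-Reasoning

      0<¼ : 0ℚ < ¼
      0<¼ = ℚₚ.positive⁻¹ ¼

      N₁ = cauchy α δ 0<δ
      N₂ = cauchy β δ 0<δ
      N₃ = cauchy γ ¼ 0<¼

    -- A single term of the three sequences that serves for all integer points of the box.
    index : ℕ
    index = proj₁ N₁ ℕ.⊔ (proj₁ N₂ ℕ.⊔ proj₁ N₃)

    stable : ∀ m → index ℕ.≤ m → ∀ x y → ℤ.∣ x ∣ ℕ.≤ M → ℤ.∣ y ∣ ℕ.≤ M →
      ∣ valueₙ m x y - valueₙ index x y ∣ ≤ ¾
    stable m i≤m x y x≤M y≤M = begin
      ∣ valueₙ m x y - valueₙ index x y ∣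
        ≡⟨ cong ∣_∣ (split (fromℤ x) (fromℤ y) (seq α m) (seq β m) (seq γ m) (seq α index) (seq β index) (seq γ index)) ⟩
      ∣ da * fromℤ x + db * fromℤ y + dc ∣ ≤⟨ ℚₚ.∣p+q∣≤∣p∣+∣q∣ (da * fromℤ x + db * fromℤ y) dc ⟩
      ∣ da * fromℤ x + db * fromℤ y ∣ + ∣ dc ∣
        ≤⟨ ℚₚ.+-monoˡ-≤ ∣ dc ∣ (ℚₚ.∣p+q∣≤∣p∣+∣q∣ (da * fromℤ x) (db * fromℤ y)) ⟩
      ∣ da * fromℤ x ∣ + ∣ db * fromℤ y ∣ + ∣ dc ∣ ≤⟨ ℚₚ.+-mono-≤ (ℚₚ.+-mono-≤
          (term da x (proj₂ N₁ m index (ℕₚ.≤-trans i₁ i≤m) i₁) x≤M)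
          (term db y (proj₂ N₂ m index (ℕₚ.≤-trans i₂ i≤m) i₂) y≤M))
          (ℚₚ.<⇒≤ (proj₂ N₃ m index (ℕₚ.≤-trans i₃ i≤m) i₃)) ⟩
      ¼ + ¼ + ¼ ≡⟨⟩
      ¾ ∎
      where
      open ℚₚ.≤-Reasoning
      da = seq α m - seq α index
      db = seq β m - seq β index
      dc = seq γ m - seq γ index
      i₁ = ℕₚ.m≤m⊔n (proj₁ N₁) (proj₁ N₂ ℕ.⊔ proj₁ N₃)
      i₂ = ℕₚ.≤-trans (ℕₚ.m≤m⊔n (proj₁ N₂) (proj₁ N₃)) (ℕₚ.m≤n⊔m (proj₁ N₁) (proj₁ N₂ ℕ.⊔ proj₁ N₃))
      i₃ = ℕₚ.≤-trans (ℕₚ.m≤n⊔m (proj₁ N₂) (proj₁ N₃)) (ℕₚ.m≤n⊔m (proj₁ N₁) (proj₁ N₂ ℕ.⊔ proj₁ N₃))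
      split : ∀ X Y a b c a′ b′ c′ →
        (X * X + Y * Y + a * X + b * Y + c) - (X * X + Y * Y + a′ * X + b′ * Y + c′)
        ≡ (a - a′) * X + (b - b′) * Y + (c - c′)
      split = solve 8 (λ X Y a b c a′ b′ c′ →
        (X :* X :+ Y :* Y :+ a :* X :+ b :* Y :+ c) :- (X :* X :+ Y :* Y :+ a′ :* X :+ b′ :* Y :+ c′)
        := (a :- a′) :* X :+ (b :- b′) :* Y :+ (c :- c′)) refl

  ∣p∣≤⇒p≤ : ∀ {p q} → ∣ p ∣ ≤ q → p ≤ q
  ∣p∣≤⇒p≤ {p} h with ℚₚ.≤-total 0ℚ p
  ... | inj₁ 0≤p = subst (_≤ _) (ℚₚ.0≤p⇒∣p∣≡p 0≤p) h
  ... | inj₂ p≤0 = ℚₚ.≤-trans p≤0 (ℚₚ.≤-trans (ℚₚ.0≤∣p∣ p) h)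

  ∣p-q∣≤⇒p≤q+ : ∀ p q r → ∣ p - q ∣ ≤ r → p ≤ q + r
  ∣p-q∣≤⇒p≤q+ p q r h = subst (_≤ q + r) (eq p q) (ℚₚ.+-monoʳ-≤ q (∣p∣≤⇒p≤ {p - q} h))
    where
    eq : ∀ p q → q + (p - q) ≡ p
    eq = solve 2 (λ p q → q :+ (p :- q) := p) refl

  ∣p-q∣≤⇒q≤p+ : ∀ p q r → ∣ p - q ∣ ≤ r → q ≤ p + r
  ∣p-q∣≤⇒q≤p+ p q r h = ∣p-q∣≤⇒p≤q+ q p r (subst (_≤ r) (trans (sym (ℚₚ.∣-p∣≡∣p∣ (p - q))) (cong ∣_∣ (eq p q))) h)
    where
    eq : ∀ p q → - (p - q) ≡ q - p
    eq = solve 2 (λ p q → :- (p :- q) := q :- p) refl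

  module Approximation (disk : Disk) (M : ℕ) where
    private
      a = proj₁ (centre disk)
      b = proj₂ (centre disk)
      r = radius disk
      α = D.- (a D.+ a)
      β = D.- (b D.+ b)
      γ = (a D.* a D.+ b D.* b) D.- r D.* r
      K = index α β γ M
      αK = seq α K
      βK = seq β K
      γK = seq γ K

      valueₙ : ℕ → ℤ → ℤ → ℚ
      valueₙ n = value (seq α n) (seq β n) (seq γ n)

      dist²ₙ : ℕ → ℤ → ℤ → ℚ
      dist²ₙ n x y = seq (dist² (point x y) (centre disk)) n

      r²ₙ : ℕ → ℚ
      r²ₙ n = seq (r D.* r) n

      -- The power of the point with respect to the disk.
      power : ∀ n x y → dist²ₙ n x y - r²ₙ n ≡ valueₙ n x y
      power n x y = eq (fromℤ x) (fromℤ y) (seq a n) (seq b n) (seq r n)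
        where
        eq : ∀ X Y a b r → ((X - a) * (X - a) + (Y - b) * (Y - b)) - r * r
          ≡ X * X + Y * Y + - (a + a) * X + - (b + b) * Y + (a * a + b * b - r * r)
        eq = solve 5 (λ X Y a b r → ((X :- a) :* (X :- a) :+ (Y :- b) :* (Y :- b)) :- r :* r
          := X :* X :+ Y :* Y :+ (:- (a :+ a)) :* X :+ (:- (b :+ b)) :* Y :+ (a :* a :+ b :* b :- r :* r)) refl

    exact : Form
    exact = clear αK βK γK

    module _ (x y : ℤ) (x≤M : ℤ.∣ x ∣ ℕ.≤ M) (y≤M : ℤ.∣ y ∣ ℕ.≤ M) where

      private
        close : ∀ n → K ℕ.≤ n → ∣ valueₙ n x y - valueₙ K x y ∣ ≤ ¾
        close n K≤n = stable α β γ M n K≤n x y x≤M y≤M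

      -- A value below - 1 at `K` stays below - ¼ from there on, which is the uniform gap that `_<_`
      -- on reals demands.
      exact-interior : outside (x , y) ∙ exact ℤ.< 0ℤ → InInterior (point x y) disk
      exact-interior neg = ¼ , ℚₚ.positive⁻¹ ¼ , K , gap
        where
        v = valueₙ K x y
        gap : ∀ n → K ℕ.≤ n → dist²ₙ n x y + ¼ < r²ₙ n
        gap n K≤n = begin-strict
          dist²ₙ n x y + ¼             ≡⟨ regroup (dist²ₙ n x y) (r²ₙ n) ⟩
          (dist²ₙ n x y - r²ₙ n) + ¼ + r²ₙ n ≡⟨ cong (λ p → p + ¼ + r²ₙ n) (power n x y) ⟩
          valueₙ n x y + ¼ + r²ₙ n     ≤⟨ ℚₚ.+-monoˡ-≤ (r²ₙ n)
            (ℚₚ.+-monoˡ-≤ ¼ (∣p-q∣≤⇒p≤q+ (valueₙ n x y) v ¾ (close n K≤n))) ⟩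
          v + ¾ + ¼ + r²ₙ n            ≡⟨ cong (_+ r²ₙ n) (ℚₚ.+-assoc v ¾ ¼) ⟩
          v + 1ℚ + r²ₙ n               <⟨ ℚₚ.+-monoˡ-< (r²ₙ n) (outside-negative αK βK γK x y neg) ⟩
          0ℚ + r²ₙ n                   ≡⟨ ℚₚ.+-identityˡ (r²ₙ n) ⟩
          r²ₙ n                        ∎
          where
          open ℚₚ.≤-Reasoning
          regroup : ∀ p r → p + ¼ ≡ (p - r) + ¼ + r
          regroup = solve 2 (λ p r → p :+ con ¼ := (p :- r) :+ con ¼ :+ r) refl

      -- The value is at most ¼ far out in the sequence, and going back to `K` costs ¾: together the
      -- slack 1 of `on`.
      exact-boundary : OnBoundary (point x y) disk → exact ⊨ on (x , y)
      exact-boundary touch = on-nonneg αK βK γK x y (begin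
        valueₙ K x y       ≤⟨ ∣p-q∣≤⇒q≤p+ (valueₙ n x y) (valueₙ K x y) ¾ (close n (ℕₚ.m≤m⊔n K (proj₁ near))) ⟩
        valueₙ n x y + ¾   ≤⟨ ℚₚ.+-monoˡ-≤ ¾ value≤¼ ⟩
        ¼ + ¾              ≡⟨⟩
        1ℚ                 ∎)
        where
        open ℚₚ.≤-Reasoning
        near = touch ¼ (ℚₚ.positive⁻¹ ¼)
        n = K ℕ.⊔ proj₁ near
        value≤¼ : valueₙ n x y ≤ ¼
        value≤¼ = subst (_≤ ¼) (power n x y)
          (∣p∣≤⇒p≤ {dist²ₙ n x y - r²ₙ n} (ℚₚ.<⇒≤ (proj₂ near n (ℕₚ.m≤n⊔m K (proj₁ near)))))

    abstract
      -- The form is kept opaque; only the following two implications are to be known about it.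
      approx : Form
      approx = exact

      interior : ∀ x y → ℤ.∣ x ∣ ℕ.≤ M → ℤ.∣ y ∣ ℕ.≤ M →
        outside (x , y) ∙ approx ℤ.< 0ℤ → InInterior (point x y) disk
      interior = exact-interior

      boundary : ∀ x y → ℤ.∣ x ∣ ℕ.≤ M → ℤ.∣ y ∣ ℕ.≤ M →
        OnBoundary (point x y) disk → approx ⊨ on (x , y)
      boundary = exact-boundary

-- The point set and a trivial cover of it

module Configurations where

  open Forms
  open Rows
  open Approximations using (fromℤ-+; fromℤ-*; fromℤ-neg; fromℤ-mono-≤; point; ¼)
  open D using (seq; Disk; InInterior; PointSet; DisjointEmptyCover)
  open import Data.Rational.Base using (0ℚ; 1ℚ)
  open ℚS using (module +-*-Solver)

  -- Indices 0 and 1 form the lower wall. Indices 2 and 3 form the upper one, its mirror image in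
  -- the line of hubs.
  height : Fin 4 → ℤ
  height 0F = + 1
  height 1F = ℤ.- + 1
  height 2F = + 2 ℤ.* h ℤ.- + 1
  height 3F = + 2 ℤ.* h ℤ.+ + 1

  height-injective : ∀ q q′ → height q ≡ height q′ → q ≡ q′
  height-injective = toWitness
    {a? = Finₚ.all? λ q → Finₚ.all? λ q′ → (height q ℤₚ.≟ height q′) →-dec (q Finₚ.≟ q′)} _

  height≢h : ∀ q → height q ≢ h
  height≢h = toWitness {a? = Finₚ.all? λ q → ¬? (height q ℤₚ.≟ h)} _

  skew : Fin 4 → ℕ → ℤ
  skew 0F j = ℤ.- tilt j
  skew 1F j = tilt j
  skew 2F j = ℤ.- tilt j
  skew 3F j = tilt j

  small-skew : ∀ q j → Small (skew q j)
  small-skew 0F j = small-neg (small-tilt j)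
  small-skew 1F j = small-tilt j
  small-skew 2F j = small-neg (small-tilt j)
  small-skew 3F j = small-tilt j

  -- Even, so that a column lies midway between two hubs, and such that half the hub distance, 14 *
  -- S, exceeds `h`; with 26 columns it would equal `h`.
  spacing : ℕ
  spacing = 28

  module Configuration (N T : ℕ) where

    data Label : Set where
      rung : Fin N → Fin 4 → Label
      hub  : Fin T → Label

    column : Label → ℕ
    column (rung c q) = toℕ c
    column (hub t)    = toℕ t ℕ.* spacing

    offset : Label → ℤ
    offset (rung c q) = skew q (toℕ c)
    offset (hub t)    = 0ℤ

    ordinate : Label → ℤ
    ordinate (rung c q) = height q
    ordinate (hub t)    = h

    small-offset : ∀ ℓ → Small (offset ℓ)
    small-offset (rung c q) = small-skew q (toℕ c)
    small-offset (hub t)    = small ℤ.-≤+ (ℤ.+≤+ z≤n)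

    abscissa : Label → ℤ
    abscissa ℓ = S ℤ.* + column ℓ ℤ.+ offset ℓ

    coords : Label → Pt
    coords ℓ = abscissa ℓ , ordinate ℓ

    size : ℕ
    size = N ℕ.* 4 ℕ.+ T

    label : Fin size → Label
    label i = [ (λ j → uncurry rung (remQuot 4 j)) , hub ]′ (splitAt (N ℕ.* 4) i)

    index : Label → Fin size
    index (rung c q) = join (N ℕ.* 4) T (inj₁ (combine c q))
    index (hub t)    = join (N ℕ.* 4) T (inj₂ t)

    label-index : ∀ ℓ → label (index ℓ) ≡ ℓ
    label-index (rung c q) = trans (cong [ (λ j → uncurry rung (remQuot 4 j)) , hub ]′
      (Finₚ.splitAt-join (N ℕ.* 4) T (inj₁ (combine c q))))
      (cong (uncurry rung) (Finₚ.remQuot-combine c q))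
    label-index (hub t) = cong [ (λ j → uncurry rung (remQuot 4 j)) , hub ]′ (Finₚ.splitAt-join (N ℕ.* 4) T (inj₂ t))

    index-label : ∀ i → index (label i) ≡ i
    index-label i = trans (lemma (splitAt (N ℕ.* 4) i)) (Finₚ.join-splitAt (N ℕ.* 4) T i)
      where
      lemma : ∀ x → index ([ (λ j → uncurry rung (remQuot 4 j)) , hub ]′ x) ≡ join (N ℕ.* 4) T x
      lemma (inj₁ j) = cong (λ j → join (N ℕ.* 4) T (inj₁ j)) (Finₚ.combine-remQuot {N} 4 j)
      lemma (inj₂ t) = refl

    label-injective : ∀ {i j} → label i ≡ label j → i ≡ j
    label-injective {i} {j} eq = trans (sym (index-label i)) (trans (cong index eq) (index-label j))

    private
      -- Columns are 10000 apart and offsets at most 4, so the abscissas differ by at least 9992.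
      column-gap : ∀ c m o o′ → Small o → Small o′ → S ℤ.* + c ℤ.+ o ≢ S ℤ.* + (1 ℕ.+ c ℕ.+ m) ℤ.+ o′
      column-gap c m o o′ s s′ eq = ℤₚ.<⇒≱ {ℤ.-[1+ 9991 ]} {0ℤ} ℤ.-<+
        (subst (0ℤ ℤ.≤_) (trans (identity (+ c) (+ m) o o′) (cancel eq))
          (0≤-* (0≤n 10000) (0≤n m) ⊹ small-≤0 s ⊹ small-0≤ s′))
        where
        cancel : ∀ {x y} → x ≡ y → y ℤ.- x ℤ.+ (ℤ.- + 9992) ≡ ℤ.- + 9992
        cancel {x} refl = trans (cong (ℤ._+ (ℤ.- + 9992)) (ℤₚ.+-inverseʳ x)) (ℤₚ.+-identityˡ (ℤ.- + 9992))
        identity : ∀ c m o o′ → + 10000 ℤ.* m ℤ.+ (+ 4 ℤ.- o) ℤ.+ (o′ ℤ.+ + 4)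
          ≡ (+ 10000 ℤ.* (+ 1 ℤ.+ c ℤ.+ m) ℤ.+ o′) ℤ.- (+ 10000 ℤ.* c ℤ.+ o) ℤ.+ (ℤ.- + 9992)
        identity = ℤR.solve-∀

      column-< : ∀ {c c′ o o′} → Small o → Small o′ → c ℕ.< c′ → S ℤ.* + c ℤ.+ o ≢ S ℤ.* + c′ ℤ.+ o′
      column-< {c} {c′} {o} {o′} s s′ c<c′ = after (ℕₚ.m≤n⇒∃[o]m+o≡n c<c′)
        where
        after : (∃ λ m → suc c ℕ.+ m ≡ c′) → S ℤ.* + c ℤ.+ o ≢ S ℤ.* + c′ ℤ.+ o′
        after (m , refl) = column-gap c m o o′ s s′

    column-injective : ∀ {c c′ o o′} → Small o → Small o′ → S ℤ.* + c ℤ.+ o ≡ S ℤ.* + c′ ℤ.+ o′ → c ≡ c′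
    column-injective {c} {c′} s s′ eq = compare (ℕₚ.<-cmp c c′)
      where
      compare : _ → c ≡ c′
      compare (tri< c<c′ _ _) = ⊥-elim (column-< s s′ c<c′ eq)
      compare (tri≈ _ c≡c′ _) = c≡c′
      compare (tri> _ _ c′<c) = ⊥-elim (column-< s′ s c′<c (sym eq))

    coords-injective : ∀ ℓ ℓ′ → abscissa ℓ ≡ abscissa ℓ′ → ordinate ℓ ≡ ordinate ℓ′ → ℓ ≡ ℓ′
    coords-injective (rung c q) (rung c′ q′) eq eq′ = cong₂ rung
      (Finₚ.toℕ-injective (column-injective (small-skew q (toℕ c)) (small-skew q′ (toℕ c′)) eq)) (height-injective q q′ eq′)
    coords-injective (rung c q) (hub t) eq eq′ = ⊥-elim (height≢h q eq′)
    coords-injective (hub t) (rung c q) eq eq′ = ⊥-elim (height≢h q (sym eq′))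
    coords-injective (hub t) (hub t′) eq eq′ = cong hub (Finₚ.toℕ-injective
      (ℕₚ.*-cancelʳ-≡ (toℕ t) (toℕ t′) spacing (column-injective (small-offset (hub t)) (small-offset (hub t′)) eq)))

    at : Label → D.Point
    at ℓ = point (abscissa ℓ) (ordinate ℓ)

  fromℚ-injective : ∀ {p q} → D.fromℚ p D.≈ D.fromℚ q → p ≡ q
  fromℚ-injective {p} {q} eq = decide (p ℚₚ.≟ q)
    where
    decide : Dec (p ≡ q) → p ≡ q
    decide (yes p≡q) = p≡q
    decide (no p≢q) = ⊥-elim (ℚₚ.<-irrefl refl (proj₂ (eq ε 0<ε) _ ℕₚ.≤-refl))
      where
      ε = ℚ.∣ p ℚ.- q ∣
      0<ε : 0ℚ ℚ.< ε
      0<ε = ℚₚ.≰⇒> λ ε≤0 → p≢q (difference (ℚₚ.∣p∣≡0⇒p≡0 (p ℚ.- q) (ℚₚ.≤-antisym ε≤0 (ℚₚ.0≤∣p∣ (p ℚ.- q)))))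
        where
        open +-*-Solver
        difference : p ℚ.- q ≡ 0ℚ → p ≡ q
        difference d = trans (solve 2 (λ p q → p := (p :- q) :+ q) refl p q) (trans (cong (ℚ._+ q) d) (ℚₚ.+-identityˡ q))

  fromℤ-injective : ∀ {i j} → fromℤ i ≡ fromℤ j → i ≡ j
  fromℤ-injective = cong ℚ.↥_

  module Points (N T : ℕ) where
    open Configuration N T

    points : PointSet size
    points = record
      { point = λ i → at (label i)
      ; distinct = λ {i} {j} (eq , eq′) → label-injective (coords-injective (label i) (label j)
          (fromℤ-injective (fromℚ-injective eq)) (fromℤ-injective (fromℚ-injective eq′)))
      }

  private
    -- The squared distance from (u , v) to the centre of `tiny x y`.
    sq : ℚ → ℚ → ℤ → ℤ → ℚ
    sq u v x y = (u ℚ.- fromℤ x) ℚ.* (u ℚ.- fromℤ x) ℚ.+ (v ℚ.- (fromℤ y ℚ.+ ¼)) ℚ.* (v ℚ.- (fromℤ y ℚ.+ ¼))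

    sq-self : ∀ x y → sq (fromℤ x) (fromℤ y) x y ≡ ¼ ℚ.* ¼
    sq-self x y = solve 2 (λ X Y → (X :- X) :* (X :- X) :+ (Y :- (Y :+ con ¼)) :* (Y :- (Y :+ con ¼))
      := con (¼ ℚ.* ¼))
      refl (fromℤ x) (fromℤ y)
      where open +-*-Solver

    square-zero : ∀ i → i ℤ.* i ≡ 0ℤ → i ≡ 0ℤ
    square-zero i eq = [ (λ z → z) , (λ z → z) ]′ (ℤₚ.i*j≡0⇒i≡0∨j≡0 i eq)

    squares-positive : ∀ i j → ¬ (i ≡ 0ℤ × j ≡ 0ℤ) → + 1 ℤ.≤ i ℤ.* i ℤ.+ j ℤ.* j
    squares-positive i j nz = ℤₚ.≮⇒≥ λ lt → nz (zeros (ℤₚ.i<j⇒i≤pred[j] lt))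
      where
      zeros : i ℤ.* i ℤ.+ j ℤ.* j ℤ.≤ 0ℤ → i ≡ 0ℤ × j ≡ 0ℤ
      zeros ≤0 = square-zero i (ℤₚ.≤-antisym (ℤₚ.≤-trans i²≤ ≤0) (square≥0 i))
               , square-zero j (ℤₚ.≤-antisym (ℤₚ.≤-trans j²≤ ≤0) (square≥0 j))
        where
        i²≤ : i ℤ.* i ℤ.≤ i ℤ.* i ℤ.+ j ℤ.* j
        i²≤ = subst (ℤ._≤ i ℤ.* i ℤ.+ j ℤ.* j) (ℤₚ.+-identityʳ (i ℤ.* i)) (ℤₚ.+-monoʳ-≤ (i ℤ.* i) (square≥0 j))
        j²≤ : j ℤ.* j ℤ.≤ i ℤ.* i ℤ.+ j ℤ.* j
        j²≤ = subst (ℤ._≤ i ℤ.* i ℤ.+ j ℤ.* j) (ℤₚ.+-identityˡ (j ℤ.* j)) (ℤₚ.+-monoˡ-≤ (j ℤ.* j) (square≥0 i))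

    square-nonneg : ∀ p → 0ℚ ℚ.≤ p ℚ.* p
    square-nonneg p = subst (0ℚ ℚ.≤_) eq (ℚₚ.0≤∣p∣ (p ℚ.* p))
      where
      eq : ℚ.∣ p ℚ.* p ∣ ≡ p ℚ.* p
      eq = [ (λ 0≤p → trans (ℚₚ.∣p*q∣≡∣p∣*∣q∣ p p) (cong₂ ℚ._*_ (ℚₚ.0≤p⇒∣p∣≡p 0≤p) (ℚₚ.0≤p⇒∣p∣≡p 0≤p)))
           , (λ p≤0 → trans (ℚₚ.∣p*q∣≡∣p∣*∣q∣ p p) (trans (cong₂ ℚ._*_ (abs p≤0) (abs p≤0)) (neg² p))) ]′ (ℚₚ.≤-total 0ℚ p)
        where
        open +-*-Solver
        abs : p ℚ.≤ 0ℚ → ℚ.∣ p ∣ ≡ ℚ.- p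
        abs p≤0 = trans (sym (ℚₚ.∣-p∣≡∣p∣ p)) (ℚₚ.0≤p⇒∣p∣≡p (ℚₚ.neg-antimono-≤ p≤0))
        neg² : ∀ p → (ℚ.- p) ℚ.* (ℚ.- p) ≡ p ℚ.* p
        neg² = solve 1 (λ p → (:- p) :* (:- p) := p :* p) refl

    -- By the parallelogram law, twice the sum of the two squares is at least the squared distance
    -- of the centres, hence at least 1. One inequality is weak so that the lemma gives emptiness as
    -- well as disjointness.
    sq-apart : ∀ u v x y x′ y′ → ¬ (x ≡ x′ × y ≡ y′) → sq u v x y ℚ.≤ ¼ ℚ.* ¼ → sq u v x′ y′ ℚ.< ¼ ℚ.* ¼ → ⊥
    sq-apart u v x y x′ y′ neq h h′ = ℚₚ.<-irrefl refl (ℚₚ.<-≤-trans total<1 1≤total)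
      where
      a b : ℚ
      a = (u ℚ.- fromℤ x) ℚ.+ (u ℚ.- fromℤ x′)
      b = (v ℚ.- (fromℤ y ℚ.+ ¼)) ℚ.+ (v ℚ.- (fromℤ y′ ℚ.+ ¼))
      whole = sq u v x y ℚ.+ sq u v x′ y′ ℚ.+ (sq u v x y ℚ.+ sq u v x′ y′)
      total<1 : whole ℚ.< 1ℚ
      total<1 = ℚₚ.<-trans (ℚₚ.+-mono-< half half) (toWitness {a? = _ ℚₚ.<? _} _)
        where
        half : sq u v x y ℚ.+ sq u v x′ y′ ℚ.< ¼ ℚ.* ¼ ℚ.+ ¼ ℚ.* ¼
        half = ℚₚ.+-mono-≤-< h h′
      difference : ∀ i j → fromℤ (i ℤ.- j) ≡ fromℤ i ℚ.- fromℤ j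
      difference i j = trans (fromℤ-+ i (ℤ.- j)) (cong (λ q → fromℤ i ℚ.+ q) (fromℤ-neg j))
      gap = (x ℤ.- x′) ℤ.* (x ℤ.- x′) ℤ.+ (y ℤ.- y′) ℤ.* (y ℤ.- y′)
      gap-eq : fromℤ gap ≡ (fromℤ x ℚ.- fromℤ x′) ℚ.* (fromℤ x ℚ.- fromℤ x′)
        ℚ.+ (fromℤ y ℚ.- fromℤ y′) ℚ.* (fromℤ y ℚ.- fromℤ y′)
      gap-eq = trans (fromℤ-+ ((x ℤ.- x′) ℤ.* (x ℤ.- x′)) ((y ℤ.- y′) ℤ.* (y ℤ.- y′)))
        (cong₂ ℚ._+_ (square x x′) (square y y′))
        where
        square : ∀ i j → fromℤ ((i ℤ.- j) ℤ.* (i ℤ.- j)) ≡ (fromℤ i ℚ.- fromℤ j) ℚ.* (fromℤ i ℚ.- fromℤ j)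
        square i j = trans (fromℤ-* (i ℤ.- j) (i ℤ.- j)) (cong₂ ℚ._*_ (difference i j) (difference i j))
      1≤gap : 1ℚ ℚ.≤ fromℤ gap
      1≤gap = fromℤ-mono-≤ (squares-positive (x ℤ.- x′) (y ℤ.- y′)
        λ (p , q) → neq (ℤₚ.i-j≡0⇒i≡j x x′ p , ℤₚ.i-j≡0⇒i≡j y y′ q))
      parallelogram : ∀ u v X Y X′ Y′ q →
        ((X ℚ.- X′) ℚ.* (X ℚ.- X′) ℚ.+ (Y ℚ.- Y′) ℚ.* (Y ℚ.- Y′))
        ℚ.+ (((u ℚ.- X) ℚ.+ (u ℚ.- X′)) ℚ.* ((u ℚ.- X) ℚ.+ (u ℚ.- X′))
             ℚ.+ ((v ℚ.- (Y ℚ.+ q)) ℚ.+ (v ℚ.- (Y′ ℚ.+ q))) ℚ.* ((v ℚ.- (Y ℚ.+ q)) ℚ.+ (v ℚ.- (Y′ ℚ.+ q))))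
        ≡ ((u ℚ.- X) ℚ.* (u ℚ.- X) ℚ.+ (v ℚ.- (Y ℚ.+ q)) ℚ.* (v ℚ.- (Y ℚ.+ q)))
          ℚ.+ ((u ℚ.- X′) ℚ.* (u ℚ.- X′) ℚ.+ (v ℚ.- (Y′ ℚ.+ q)) ℚ.* (v ℚ.- (Y′ ℚ.+ q)))
          ℚ.+ (((u ℚ.- X) ℚ.* (u ℚ.- X) ℚ.+ (v ℚ.- (Y ℚ.+ q)) ℚ.* (v ℚ.- (Y ℚ.+ q)))
               ℚ.+ ((u ℚ.- X′) ℚ.* (u ℚ.- X′) ℚ.+ (v ℚ.- (Y′ ℚ.+ q)) ℚ.* (v ℚ.- (Y′ ℚ.+ q))))
      parallelogram = solve 7 (λ u v X Y X′ Y′ q →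
        ((X :- X′) :* (X :- X′) :+ (Y :- Y′) :* (Y :- Y′))
        :+ (((u :- X) :+ (u :- X′)) :* ((u :- X) :+ (u :- X′))
             :+ ((v :- (Y :+ q)) :+ (v :- (Y′ :+ q))) :* ((v :- (Y :+ q)) :+ (v :- (Y′ :+ q))))
        := ((u :- X) :* (u :- X) :+ (v :- (Y :+ q)) :* (v :- (Y :+ q)))
          :+ ((u :- X′) :* (u :- X′) :+ (v :- (Y′ :+ q)) :* (v :- (Y′ :+ q)))
          :+ (((u :- X) :* (u :- X) :+ (v :- (Y :+ q)) :* (v :- (Y :+ q)))
               :+ ((u :- X′) :* (u :- X′) :+ (v :- (Y′ :+ q)) :* (v :- (Y′ :+ q))))) refl
        where open +-*-Solver
      1≤total : 1ℚ ℚ.≤ whole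
      1≤total = subst (1ℚ ℚ.≤_) (parallelogram u v (fromℤ x) (fromℤ y) (fromℤ x′) (fromℤ y′) ¼)
        (ℚₚ.+-mono-≤ (subst (1ℚ ℚ.≤_) gap-eq 1≤gap) (ℚₚ.+-mono-≤ (square-nonneg a) (square-nonneg b)))

  -- It touches (x , y) from above. Such disks provide a cover, so that the set of possible numbers
  -- of disks is inhabited.
  tiny : ℤ → ℤ → Disk
  tiny x y = record
    { centre = D.fromℚ (fromℤ x) , D.fromℚ (fromℤ y ℚ.+ ¼)
    ; radius = D.fromℚ ¼
    ; radius>0 = + 1 ℚ./ 8 , ℚₚ.positive⁻¹ (+ 1 ℚ./ 8) , 0 , λ _ _ → toWitness {a? = (0ℚ ℚ.+ + 1 ℚ./ 8) ℚₚ.<? ¼} _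
    }

  private
    <-from-gap : ∀ {p q ε} → 0ℚ ℚ.< ε → p ℚ.+ ε ℚ.< q → p ℚ.< q
    <-from-gap {p} {q} {ε} 0<ε lt = ℚₚ.<-trans (subst (ℚ._< p ℚ.+ ε) (ℚₚ.+-identityʳ p) (ℚₚ.+-monoʳ-< p 0<ε)) lt

  module TinyCover (N T : ℕ) where
    open Configuration N T
    open Points N T

    private
      disk′ : Fin size → Disk
      disk′ i = tiny (abscissa (label i)) (ordinate (label i))

      differ : ∀ {i j} → i ≢ j → ¬ (abscissa (label i) ≡ abscissa (label j) × ordinate (label i) ≡ ordinate (label j))
      differ {i} {j} i≢j (eq , eq′) = i≢j (label-injective (coords-injective (label i) (label j) eq eq′))

    tiny-cover : DisjointEmptyCover points size
    tiny-cover = record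
      { disk = disk′
      ; disjoint = λ i j i≢j p → disjoint′ i j i≢j p
      ; empty = λ i j → empty′ i j (i Finₚ.≟ j)
      ; covers = λ i → i , λ ε 0<ε → 0 , λ _ _ → subst (λ q → ℚ.∣ q ∣ ℚ.< ε) (sym (zero-gap i)) 0<ε
      }
      where
      zero-gap : ∀ i → sq (fromℤ (abscissa (label i))) (fromℤ (ordinate (label i))) (abscissa (label i)) (ordinate (label i))
        ℚ.- ¼ ℚ.* ¼ ≡ 0ℚ
      zero-gap i = trans (cong (ℚ._- ¼ ℚ.* ¼) (sq-self (abscissa (label i)) (ordinate (label i)))) (ℚₚ.+-inverseʳ (¼ ℚ.* ¼))

      disjoint′ : ∀ i j → i ≢ j → D.InteriorsDisjoint (disk′ i) (disk′ j)
      disjoint′ i j i≢j p ((ε , 0<ε , n , h) , (ε′ , 0<ε′ , n′ , h′)) =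
        sq-apart (seq (proj₁ p) m) (seq (proj₂ p) m) (abscissa (label i)) (ordinate (label i))
          (abscissa (label j)) (ordinate (label j)) (differ i≢j)
          (ℚₚ.<⇒≤ (<-from-gap 0<ε (h m (ℕₚ.m≤m⊔n n n′)))) (<-from-gap 0<ε′ (h′ m (ℕₚ.m≤n⊔m n n′)))
        where m = n ℕ.⊔ n′

      empty′ : ∀ i j → Dec (i ≡ j) → ¬ InInterior (D.point points j) (disk′ i)
      empty′ i .i (yes refl) (ε , 0<ε , n , h) = ℚₚ.<-irrefl (sq-self (abscissa (label i)) (ordinate (label i)))
        (<-from-gap 0<ε (h n ℕₚ.≤-refl))
      empty′ i j (no i≢j) (ε , 0<ε , n , h) =
        sq-apart (fromℤ (abscissa (label j))) (fromℤ (ordinate (label j))) (abscissa (label j)) (ordinate (label j))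
          (abscissa (label i)) (ordinate (label i)) (differ (λ eq → i≢j (sym eq)))
          (ℚₚ.≤-reflexive (sq-self (abscissa (label j)) (ordinate (label j)))) (<-from-gap 0<ε (h n ℕₚ.≤-refl))

-- Counting the disks of a cover

module Counting where

  open Forms
  open Rows
  open Walls
  open Approximations using (point; module Approximation)
  open Configurations
  open D using (DisjointEmptyCover)
  open Form

  private
    reflect-outside-identity : ∀ H x y d a b c →
      (x ℤ.* x ℤ.+ y ℤ.* y ℤ.+ + 1) ℤ.* d ℤ.+ x ℤ.* a ℤ.+ y ℤ.* (ℤ.- (b ℤ.+ + 2 ℤ.* H ℤ.* d))
        ℤ.+ + 1 ℤ.* (c ℤ.+ H ℤ.* H ℤ.* d ℤ.+ H ℤ.* b)
      ≡ (x ℤ.* x ℤ.+ (H ℤ.- y) ℤ.* (H ℤ.- y) ℤ.+ + 1) ℤ.* d ℤ.+ x ℤ.* a ℤ.+ (H ℤ.- y) ℤ.* b ℤ.+ + 1 ℤ.* c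
    reflect-outside-identity = ℤR.solve-∀

    reflect-on-identity : ∀ H x y d a b c →
      (+ 1 ℤ.- (x ℤ.* x ℤ.+ y ℤ.* y)) ℤ.* d ℤ.+ (ℤ.- x) ℤ.* a ℤ.+ (ℤ.- y) ℤ.* (ℤ.- (b ℤ.+ + 2 ℤ.* H ℤ.* d))
        ℤ.+ (ℤ.- + 1) ℤ.* (c ℤ.+ H ℤ.* H ℤ.* d ℤ.+ H ℤ.* b)
      ≡ (+ 1 ℤ.- (x ℤ.* x ℤ.+ (H ℤ.- y) ℤ.* (H ℤ.- y))) ℤ.* d ℤ.+ (ℤ.- x) ℤ.* a ℤ.+ (ℤ.- (H ℤ.- y)) ℤ.* b ℤ.+ (ℤ.- + 1) ℤ.* c
    reflect-on-identity = ℤR.solve-∀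

  abstract
    -- Reflection in the line of hubs turns the upper wall into a lower one.
    reflect : Form → Form
    reflect f = form (scale f) (x-coeff f) (ℤ.- (y-coeff f ℤ.+ + 2 ℤ.* (+ 2 ℤ.* h) ℤ.* scale f))
      (const f ℤ.+ (+ 2 ℤ.* h) ℤ.* (+ 2 ℤ.* h) ℤ.* scale f ℤ.+ (+ 2 ℤ.* h) ℤ.* y-coeff f) (scale>0 f)

    reflect-outside : ∀ f x y y′ → + 2 ℤ.* h ℤ.- y ≡ y′ → f ⊨ outside (x , y′) → reflect f ⊨ outside (x , y)
    reflect-outside f x y _ refl = subst (0ℤ ℤ.≤_)
      (sym (reflect-outside-identity (+ 2 ℤ.* h) x y (scale f) (x-coeff f) (y-coeff f) (const f)))

    reflect-on : ∀ f x y y′ → + 2 ℤ.* h ℤ.- y ≡ y′ → f ⊨ on (x , y′) → reflect f ⊨ on (x , y)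
    reflect-on f x y _ refl = subst (0ℤ ℤ.≤_)
      (sym (reflect-on-identity (+ 2 ℤ.* h) x y (scale f) (x-coeff f) (y-coeff f) (const f)))


  private
    -- The average of the two wall points is the point of the chord between them, with value larger
    -- by (H - 1)² on average at the wall. The chord contributes minus the product of its two parts,
    -- at least K², which is greater than (H - 1)² and the slack.
    midpoint-identity : ∀ x p q d a b c K H →
      + 2 ℤ.* (q ℤ.+ K) ℤ.* ((+ 1 ℤ.- (x ℤ.* x ℤ.+ H ℤ.* H)) ℤ.* d ℤ.+ (ℤ.- x) ℤ.* a ℤ.+ (ℤ.- H) ℤ.* b ℤ.+ (ℤ.- + 1) ℤ.* c)
      ℤ.+ + 2 ℤ.* (p ℤ.+ K) ℤ.* ((+ 1 ℤ.- ((x ℤ.+ (p ℤ.+ K) ℤ.+ (q ℤ.+ K)) ℤ.* (x ℤ.+ (p ℤ.+ K) ℤ.+ (q ℤ.+ K)) ℤ.+ H ℤ.* H)) ℤ.* d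
            ℤ.+ (ℤ.- (x ℤ.+ (p ℤ.+ K) ℤ.+ (q ℤ.+ K))) ℤ.* a ℤ.+ (ℤ.- H) ℤ.* b ℤ.+ (ℤ.- + 1) ℤ.* c)
      ℤ.+ (p ℤ.+ K ℤ.+ (q ℤ.+ K)) ℤ.*
        (((x ℤ.+ (p ℤ.+ K)) ℤ.* (x ℤ.+ (p ℤ.+ K)) ℤ.+ + 1 ℤ.* + 1 ℤ.+ + 1) ℤ.* d ℤ.+ (x ℤ.+ (p ℤ.+ K)) ℤ.* a
         ℤ.+ + 1 ℤ.* b ℤ.+ + 1 ℤ.* c
         ℤ.+ (((x ℤ.+ (p ℤ.+ K)) ℤ.* (x ℤ.+ (p ℤ.+ K)) ℤ.+ (+ 2 ℤ.* H ℤ.- + 1) ℤ.* (+ 2 ℤ.* H ℤ.- + 1) ℤ.+ + 1) ℤ.* d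
              ℤ.+ (x ℤ.+ (p ℤ.+ K)) ℤ.* a ℤ.+ (+ 2 ℤ.* H ℤ.- + 1) ℤ.* b ℤ.+ + 1 ℤ.* c))
      ℤ.+ (p ℤ.+ K ℤ.+ (q ℤ.+ K)) ℤ.* (p ℤ.* q ℤ.+ K ℤ.* p ℤ.+ K ℤ.* q ℤ.+ (p ℤ.* q ℤ.+ K ℤ.* p ℤ.+ K ℤ.* q)) ℤ.* d
      ℤ.+ (p ℤ.+ q) ℤ.* (+ 2 ℤ.* K ℤ.* K ℤ.+ + 4 ℤ.* H ℤ.- + 2 ℤ.* H ℤ.* H ℤ.- + 6) ℤ.* d
      ≡ (ℤ.- (+ 2 ℤ.* K ℤ.* (+ 2 ℤ.* K ℤ.* K ℤ.+ + 4 ℤ.* H ℤ.- + 2 ℤ.* H ℤ.* H ℤ.- + 6))) ℤ.* d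
    midpoint-identity = ℤR.solve-∀

  -- A disk touching two points of the centre line far apart contains a point of
  -- a wall between them: no disk touches two hubs.
  midpoint : ∀ f x p q → 0ℤ ℤ.≤ p → 0ℤ ℤ.≤ q →
    f ⊨ on (x , h) → f ⊨ on (x ℤ.+ (p ℤ.+ + 139990) ℤ.+ (q ℤ.+ + 139990) , h) →
    f ⊨ outside (x ℤ.+ (p ℤ.+ + 139990) , + 1) → f ⊨ outside (x ℤ.+ (p ℤ.+ + 139990) , + 2 ℤ.* h ℤ.- + 1) → ⊥
  midpoint f x p q 0≤p 0≤q h₁ h₂ h₃ h₄ = scale-negative f
    (ℤ.- (+ 2 ℤ.* K ℤ.* (+ 2 ℤ.* K ℤ.* K ℤ.+ + 4 ℤ.* h ℤ.- + 2 ℤ.* h ℤ.* h ℤ.- + 6))) ℤ.-<+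
    (subst (0ℤ ℤ.≤_) (midpoint-identity x p q (scale f) (x-coeff f) (y-coeff f) (const f) K h)
      (0≤-* (0≤-* (0≤n 2) 0≤Q) h₁ ⊹ 0≤-* (0≤-* (0≤n 2) 0≤P) h₂ ⊹ 0≤-* (0≤P ⊹ 0≤Q) (h₃ ⊹ h₄)
       ⊹ 0≤-* (0≤-* (0≤P ⊹ 0≤Q) (0≤excess ⊹ 0≤excess)) (scale≥0 f)
       ⊹ 0≤-* (0≤-* (0≤p ⊹ 0≤q) 0≤C) (scale≥0 f)))
    where
    K = + 139990
    0≤K : 0ℤ ℤ.≤ K
    0≤K = 0≤n 139990
    0≤P : 0ℤ ℤ.≤ p ℤ.+ K
    0≤P = 0≤p ⊹ 0≤K
    0≤Q : 0ℤ ℤ.≤ q ℤ.+ K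
    0≤Q = 0≤q ⊹ 0≤K
    0≤excess : 0ℤ ℤ.≤ p ℤ.* q ℤ.+ K ℤ.* p ℤ.+ K ℤ.* q
    0≤excess = 0≤-* 0≤p 0≤q ⊹ 0≤-* 0≤K 0≤p ⊹ 0≤-* 0≤K 0≤q
    0≤C : 0ℤ ℤ.≤ + 2 ℤ.* K ℤ.* K ℤ.+ + 4 ℤ.* h ℤ.- + 2 ℤ.* h ℤ.* h ℤ.- + 6
    0≤C = ℤ.+≤+ z≤n

  one-nonneg : ∀ a b → ¬ (a ℤ.< 0ℤ × b ℤ.< 0ℤ) → 0ℤ ℤ.≤ a ⊎ 0ℤ ℤ.≤ b
  one-nonneg a b not-both with a ℤₚ.<? 0ℤ | b ℤₚ.<? 0ℤ
  ... | no a≮0 | _      = inj₁ (ℤₚ.≮⇒≥ a≮0)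
  ... | yes _  | no b≮0 = inj₂ (ℤₚ.≮⇒≥ b≮0)
  ... | yes a<0 | yes b<0 = ⊥-elim (not-both (a<0 , b<0))

  glue-injective : ∀ {A B C : Set} {f : A → C} {g : B → C} →
    Injective _≡_ _≡_ f → Injective _≡_ _≡_ g → (∀ a b → f a ≢ g b) → Injective _≡_ _≡_ [ f , g ]′
  glue-injective f-inj g-inj f≢g {inj₁ a} {inj₁ a′} eq = cong inj₁ (f-inj eq)
  glue-injective f-inj g-inj f≢g {inj₁ a} {inj₂ b}  eq = ⊥-elim (f≢g a b eq)
  glue-injective f-inj g-inj f≢g {inj₂ b} {inj₁ a}  eq = ⊥-elim (f≢g a b (sym eq))
  glue-injective f-inj g-inj f≢g {inj₂ b} {inj₂ b′} eq = cong inj₂ (g-inj eq)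

  splitAt-injective : ∀ m {n} → Injective _≡_ _≡_ (splitAt m {n})
  splitAt-injective m {n} {i} {j} eq =
    trans (sym (Finₚ.join-splitAt m n i)) (trans (cong (join m n) eq) (Finₚ.join-splitAt m n j))

  sum-≤ : ∀ {a b c k} {f : Fin a → Fin k} {g : Fin b → Fin k} {o : Fin c → Fin k} →
    Injective _≡_ _≡_ f → Injective _≡_ _≡_ g → Injective _≡_ _≡_ o →
    (∀ i j → f i ≢ g j) → (∀ i j → f i ≢ o j) → (∀ i j → g i ≢ o j) → a ℕ.+ (b ℕ.+ c) ℕ.≤ k
  sum-≤ {a} {b} f-inj g-inj o-inj f≢g f≢o g≢o = Finₚ.injective⇒≤
    (splitAt-injective a ∘ glue-injective f-inj (splitAt-injective b ∘ glue-injective g-inj o-inj g≢o)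
      (λ i j → [ f≢g i , f≢o i ]-avoids (splitAt b j)))
    where
    [_,_]-avoids : ∀ {A B C : Set} {f : C} {g : A → C} {o : B → C} → (∀ j → f ≢ g j) → (∀ j → f ≢ o j) →
      ∀ x → f ≢ [ g , o ]′ x
    [ p , q ]-avoids (inj₁ j) = p j
    [ p , q ]-avoids (inj₂ j) = q j

  linear-bound : ∀ m c x w v → c ℕ.≤ w → ℤ.∣ x ∣ ℕ.≤ v → ℤ.∣ + m ℤ.* + c ℤ.+ x ∣ ℕ.≤ w ℕ.* m ℕ.+ v
  linear-bound m c x w v c≤w x≤v = ℕₚ.≤-trans (ℤₚ.∣i+j∣≤∣i∣+∣j∣ (+ m ℤ.* + c) x)
    (ℕₚ.+-mono-≤ (subst (ℕ._≤ w ℕ.* m) (sym (trans (ℤₚ.abs-* (+ m) (+ c)) (ℕₚ.*-comm m c))) (ℕₚ.*-monoˡ-≤ m c≤w)) x≤v)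

  -- There are `s` blocks of 28 columns with a hub each, and `e` further hubs beyond the walls to
  -- adjust the number of points.
  module LowerBound (s₀ e : ℕ) where

    s N T′ : ℕ
    s  = suc s₀
    N  = s ℕ.* spacing
    T′ = s ℕ.+ e

    open Configuration N T′
    open Points N T′

    interior-rungs : ℕ
    interior-rungs = 22 ℕ.+ s₀ ℕ.* spacing

    6+interior≡N : 6 ℕ.+ interior-rungs ≡ N
    6+interior≡N = refl

    -- One bound for all points and meeting points; 310000 = 2 * h + 50000 allows for meeting points
    -- reflected to the upper wall.
    width bound : ℕ
    width = N ℕ.+ T′ ℕ.* spacing
    bound = width ℕ.* 10000 ℕ.+ 310000

    module Cover {k : ℕ} (cover : DisjointEmptyCover points k) where
      open DisjointEmptyCover cover

      F : Fin k → Form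
      F i = Approximation.approx (disk i) bound

      chosen : Fin size → Fin k
      chosen p = proj₁ (covers p)

      δ : Label → Fin k
      δ ℓ = chosen (index ℓ)

      x-bound : ∀ c x → c ℕ.≤ width → ℤ.∣ x ∣ ℕ.≤ 50000 → ℤ.∣ S ℤ.* + c ℤ.+ x ∣ ℕ.≤ bound
      x-bound c x c≤ x≤ = linear-bound 10000 c x width 310000 c≤ (ℕₚ.≤-trans x≤ (toWitness {a? = 50000 ℕₚ.≤? 310000} _))

      y-bound : ∀ y → ℤ.∣ y ∣ ℕ.≤ 310000 → ℤ.∣ y ∣ ℕ.≤ bound
      y-bound y y≤ = ℕₚ.≤-trans y≤ (ℕₚ.m≤n+m 310000 (width ℕ.* 10000))

      column≤width : ∀ ℓ → column ℓ ℕ.≤ width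
      column≤width (rung c q) = ℕₚ.≤-trans (ℕₚ.<⇒≤ (Finₚ.toℕ<n c)) (ℕₚ.m≤m+n N (T′ ℕ.* spacing))
      column≤width (hub t)    = ℕₚ.≤-trans (ℕₚ.*-monoˡ-≤ spacing (ℕₚ.<⇒≤ (Finₚ.toℕ<n t))) (ℕₚ.m≤n+m (T′ ℕ.* spacing) N)

      offset-bound : ∀ {o} → Small o → ℤ.∣ o ∣ ℕ.≤ 50000
      offset-bound {+ n} (small _ (ℤ.+≤+ n≤4)) = ℕₚ.≤-trans n≤4 (toWitness {a? = 4 ℕₚ.≤? 50000} _)
      offset-bound { -[1+ n ]} (small (ℤ.-≤- n≤3) _) = ℕₚ.≤-trans (s≤s n≤3) (toWitness {a? = 4 ℕₚ.≤? 50000} _)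

      ordinate-bound : ∀ ℓ → ℤ.∣ ordinate ℓ ∣ ℕ.≤ 310000
      ordinate-bound (rung c q) = toWitness {a? = Finₚ.all? λ q → ℤ.∣ height q ∣ ℕₚ.≤? 310000} _ q
      ordinate-bound (hub t)    = toWitness {a? = 130000 ℕₚ.≤? 310000} _

      coords-x-bound : ∀ ℓ → ℤ.∣ abscissa ℓ ∣ ℕ.≤ bound
      coords-x-bound ℓ = x-bound (column ℓ) (offset ℓ) (column≤width ℓ) (offset-bound (small-offset ℓ))

      coords-y-bound : ∀ ℓ → ℤ.∣ ordinate ℓ ∣ ℕ.≤ bound
      coords-y-bound ℓ = y-bound (ordinate ℓ) (ordinate-bound ℓ)

      on-chosen : ∀ p → F (chosen p) ⊨ on (coords (label p))
      on-chosen p = Approximation.boundary (disk (chosen p)) bound (abscissa (label p)) (ordinate (label p))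
        (coords-x-bound (label p)) (coords-y-bound (label p)) (proj₂ (covers p))

      on-δ : ∀ ℓ → F (δ ℓ) ⊨ on (coords ℓ)
      on-δ ℓ = subst (λ ℓ′ → F (δ ℓ) ⊨ on (coords ℓ′)) (label-index ℓ) (on-chosen (index ℓ))

      off : ∀ i ℓ → F i ⊨ outside (coords ℓ)
      off i ℓ = subst (λ ℓ′ → F i ⊨ outside (coords ℓ′)) (label-index ℓ) (ℤₚ.≮⇒≥ λ neg → empty i (index ℓ)
        (Approximation.interior (disk i) bound (abscissa (label (index ℓ))) (ordinate (label (index ℓ)))
          (coords-x-bound (label (index ℓ))) (coords-y-bound (label (index ℓ))) neg))

      separate : ∀ {i i′} → i ≢ i′ → ∀ x y → ℤ.∣ x ∣ ℕ.≤ bound → ℤ.∣ y ∣ ℕ.≤ bound →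
        F i ⊨ outside (x , y) ⊎ F i′ ⊨ outside (x , y)
      separate {i} {i′} i≢i′ x y x≤ y≤ = one-nonneg (outside (x , y) ∙ F i) (outside (x , y) ∙ F i′)
        λ (neg , neg′) → disjoint i i′ i≢i′ (point x y)
          (Approximation.interior (disk i) bound x y x≤ y≤ neg , Approximation.interior (disk i′) bound x y x≤ y≤ neg′)

      -- Reduction modulo `N` only makes the function total; it changes nothing for columns below
      -- `N`.
      strut : ℕ → Fin 4 → Label
      strut j q = rung (j mod N) q

      toℕ-mod : ∀ {j} → j ℕ.< N → toℕ (j mod N) ≡ j
      toℕ-mod {j} j<N = trans (Finₚ.toℕ-fromℕ< _) (m<n⇒m%n≡m j<N)

      on-strut : ∀ q j → j ℕ.< N → F (δ (strut j q)) ⊨ on (S ℤ.* + j ℤ.+ skew q j , height q)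
      on-strut q j j<N = subst (λ c → F (δ (strut j q)) ⊨ on (S ℤ.* + c ℤ.+ skew q c , height q))
        (toℕ-mod j<N) (on-δ (strut j q))

      off-strut : ∀ q i j → j ℕ.< N → F i ⊨ outside (S ℤ.* + j ℤ.+ skew q j , height q)
      off-strut q i j j<N = subst (λ c → F i ⊨ outside (S ℤ.* + c ℤ.+ skew q c , height q))
        (toℕ-mod j<N) (off i (strut j q))

      in-box : ∀ x y → T (inBox (x , y)) → ℤ.∣ x ∣ ℕ.≤ 50000 × ℤ.∣ y ∣ ℕ.≤ 50000
      in-box x y t = let tx , ty = Equivalence.to Boolₚ.T-∧ t in ℕₚ.≤ᵇ⇒≤ ℤ.∣ x ∣ 50000 tx , ℕₚ.≤ᵇ⇒≤ ℤ.∣ y ∣ 50000 ty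

      x-in-box : ∀ j → j ℕ.< N → ∀ x y → T (inBox (x , y)) → ℤ.∣ S ℤ.* + j ℤ.+ x ∣ ℕ.≤ bound
      x-in-box j j<N x y t = x-bound j x (ℕₚ.≤-trans (ℕₚ.<⇒≤ j<N) (ℕₚ.m≤m+n N (T′ ℕ.* spacing))) (proj₁ (in-box x y t))

      -- What makes a disk inner for the lower and for the upper wall, respectively. Hubs count for
      -- both.
      upper lower : Label → Bool
      upper (rung _ 0F) = false
      upper (rung _ 1F) = false
      upper _           = true
      lower (rung _ 2F) = false
      lower (rung _ 3F) = false
      lower _           = true

      -- Contact is read off the choice made by `covers`, not off the real equation `OnBoundary`,
      -- and is thereby decidable.
      Touches : (Label → Bool) → Fin k → Set
      Touches select i = ∃ λ p → T (select (label p)) × chosen p ≡ i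

      touches? : ∀ select i → Dec (Touches select i)
      touches? select i = Finₚ.any? λ p → Boolₚ.T? (select (label p)) ×-dec (chosen p Finₚ.≟ i)

      δ-touches : ∀ select ℓ → T (select ℓ) → Touches select (δ ℓ)
      δ-touches select ℓ t = index ℓ , subst (T ∘ select) (sym (label-index ℓ)) t , refl

      upper-high : ∀ ℓ → T (upper ℓ) → h ℤ.≤ ordinate ℓ
      upper-high (rung _ 0F) ()
      upper-high (rung _ 1F) ()
      upper-high (rung _ 2F) _ = toWitness {a? = h ℤₚ.≤? height 2F} _
      upper-high (rung _ 3F) _ = toWitness {a? = h ℤₚ.≤? height 3F} _
      upper-high (hub _)     _ = ℤₚ.≤-refl

      lower-low : ∀ ℓ → T (lower ℓ) → h ℤ.≤ + 2 ℤ.* h ℤ.- ordinate ℓ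
      lower-low (rung _ 0F) _ = toWitness {a? = h ℤₚ.≤? + 2 ℤ.* h ℤ.- height 0F} _
      lower-low (rung _ 1F) _ = toWitness {a? = h ℤₚ.≤? + 2 ℤ.* h ℤ.- height 1F} _
      lower-low (rung _ 2F) ()
      lower-low (rung _ 3F) ()
      lower-low (hub _)     _ = toWitness {a? = h ℤₚ.≤? + 2 ℤ.* h ℤ.- h} _

      module Bottom where
        high : ∀ i → Touches upper i → ∃ λ X → ∃ λ Z → h ℤ.≤ Z × F i ⊨ on (X , Z)
        high i (p , t , eq) = abscissa (label p) , ordinate (label p) , upper-high (label p) t
          , subst (λ i → F i ⊨ on (coords (label p))) eq (on-chosen p)

        apart : ∀ {i i′} → i ≢ i′ → ∀ j → j ℕ.< N → ∀ x y → T (inBox (x , y)) →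
          F i ⊨ outside (S ℤ.* + j ℤ.+ x , y) ⊎ F i′ ⊨ outside (S ℤ.* + j ℤ.+ x , y)
        apart i≢i′ j j<N x y t = separate i≢i′ (S ℤ.* + j ℤ.+ x) y (x-in-box j j<N x y t)
          (y-bound y (ℕₚ.≤-trans (proj₂ (in-box x y t)) (toWitness {a? = 50000 ℕₚ.≤? 310000} _)))

        open Wall N F (λ j → δ (strut j 0F)) (λ j → δ (strut j 1F)) (Touches upper) (touches? upper)
          (on-strut 0F) (on-strut 1F) (off-strut 0F) (off-strut 1F) (off-strut 2F) high apart
        open Touching.Charging (λ j → δ (strut j 0F)) (λ j → δ (strut j 1F)) (Touches upper) N (touches? upper)
          not-adjacent inner-upper not-both-left not-both-right end-end end-middle-end end-middle-middle

        assign : Fin interior-rungs → Fin k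
        assign = charge 6+interior≡N

        assign-injective : Injective _≡_ _≡_ assign
        assign-injective = charge-injective 6+interior≡N

        assign-outer : ∀ b → ¬ Touches upper (assign b)
        assign-outer b = claim-outer (charge-claim 6+interior≡N b)

      module Ceiling where
        high : ∀ i → Touches lower i → ∃ λ X → ∃ λ Z → h ℤ.≤ Z × reflect (F i) ⊨ on (X , Z)
        high i (p , t , eq) = abscissa (label p) , + 2 ℤ.* h ℤ.- ordinate (label p) , lower-low (label p) t
          , reflect-on (F i) (abscissa (label p)) (+ 2 ℤ.* h ℤ.- ordinate (label p)) (ordinate (label p))
              (twice (+ 2 ℤ.* h) (ordinate (label p)))
              (subst (λ i → F i ⊨ on (coords (label p))) eq (on-chosen p))
          where
          twice : ∀ H y → H ℤ.- (H ℤ.- y) ≡ y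
          twice = ℤR.solve-∀

        apart : ∀ {i i′} → i ≢ i′ → ∀ j → j ℕ.< N → ∀ x y → T (inBox (x , y)) →
          reflect (F i) ⊨ outside (S ℤ.* + j ℤ.+ x , y) ⊎ reflect (F i′) ⊨ outside (S ℤ.* + j ℤ.+ x , y)
        apart {i} {i′} i≢i′ j j<N x y t =
          [ (λ p → inj₁ (reflect-outside (F i) (S ℤ.* + j ℤ.+ x) y (+ 2 ℤ.* h ℤ.- y) refl p))
          , (λ p → inj₂ (reflect-outside (F i′) (S ℤ.* + j ℤ.+ x) y (+ 2 ℤ.* h ℤ.- y) refl p)) ]′
          (separate i≢i′ (S ℤ.* + j ℤ.+ x) (+ 2 ℤ.* h ℤ.- y) (x-in-box j j<N x y t)
            (y-bound (+ 2 ℤ.* h ℤ.- y) (ℕₚ.≤-trans (ℤₚ.∣i-j∣≤∣i∣+∣j∣ (+ 2 ℤ.* h) y)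
              (ℕₚ.≤-trans (ℕₚ.+-monoʳ-≤ 260000 (proj₂ (in-box x y t))) (toWitness {a? = 310000 ℕₚ.≤? 310000} _)))))

        on-A : ∀ j → j ℕ.< N → reflect (F (δ (strut j 2F))) ⊨ on (S ℤ.* + j ℤ.+ skew 2F j , + 1)
        on-A j j<N = reflect-on (F (δ (strut j 2F))) (S ℤ.* + j ℤ.+ skew 2F j) (+ 1) (height 2F) refl (on-strut 2F j j<N)

        on-B : ∀ j → j ℕ.< N → reflect (F (δ (strut j 3F))) ⊨ on (S ℤ.* + j ℤ.+ skew 3F j , ℤ.- + 1)
        on-B j j<N = reflect-on (F (δ (strut j 3F))) (S ℤ.* + j ℤ.+ skew 3F j) (ℤ.- + 1) (height 3F) refl (on-strut 3F j j<N)

        off-A : ∀ i j → j ℕ.< N → reflect (F i) ⊨ outside (S ℤ.* + j ℤ.+ skew 2F j , + 1)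
        off-A i j j<N = reflect-outside (F i) (S ℤ.* + j ℤ.+ skew 2F j) (+ 1) (height 2F) refl (off-strut 2F i j j<N)

        off-B : ∀ i j → j ℕ.< N → reflect (F i) ⊨ outside (S ℤ.* + j ℤ.+ skew 3F j , ℤ.- + 1)
        off-B i j j<N = reflect-outside (F i) (S ℤ.* + j ℤ.+ skew 3F j) (ℤ.- + 1) (height 3F) refl (off-strut 3F i j j<N)

        off-bottom : ∀ i j → j ℕ.< N → reflect (F i) ⊨ outside (S ℤ.* + j ℤ.+ skew 0F j , + 2 ℤ.* h ℤ.- + 1)
        off-bottom i j j<N = reflect-outside (F i) (S ℤ.* + j ℤ.+ skew 0F j) (+ 2 ℤ.* h ℤ.- + 1) (+ 1)
          refl (off-strut 0F i j j<N)

        open Touching (λ j → δ (strut j 2F)) (λ j → δ (strut j 3F)) (Touches lower) using (Own)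
        open Wall N (λ i → reflect (F i)) (λ j → δ (strut j 2F)) (λ j → δ (strut j 3F))
          (Touches lower) (touches? lower) on-A on-B
          off-A off-B off-bottom high apart
        open Touching.Charging (λ j → δ (strut j 2F)) (λ j → δ (strut j 3F)) (Touches lower) N (touches? lower)
          not-adjacent inner-upper not-both-left not-both-right end-end end-middle-end end-middle-middle

        assign : Fin interior-rungs → Fin k
        assign = charge 6+interior≡N

        assign-injective : Injective _≡_ _≡_ assign
        assign-injective = charge-injective 6+interior≡N

        assign-outer : ∀ b → ¬ Touches lower (assign b)
        assign-outer b = claim-outer (charge-claim 6+interior≡N b)

        own-upper : ∀ {j i} → Own j i → Touches upper i
        own-upper {j} (inj₁ refl) = δ-touches upper (strut j 2F) tt
        own-upper {j} (inj₂ refl) = δ-touches upper (strut j 3F) tt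

        -- This separates the two walls, as disks charged to the lower wall do not touch the upper
        -- one.
        assign-upper : ∀ b → Touches upper (assign b)
        assign-upper b = own-upper {2 ℕ.+ toℕ b} (claim-own (charge-claim 6+interior≡N b))

      private
        hub-identity : ∀ a m τ →
          + 10000 ℤ.* (a ℤ.+ (+ 28 ℤ.+ m)) ℤ.+ 0ℤ
          ≡ + 10000 ℤ.* a ℤ.+ 0ℤ ℤ.+ (+ 10 ℤ.- τ ℤ.+ + 139990) ℤ.+ (+ 10 ℤ.+ + 10000 ℤ.* m ℤ.+ τ ℤ.+ + 139990)
        hub-identity = ℤR.solve-∀

        middle-identity : ∀ a τ →
          + 10000 ℤ.* (a ℤ.+ + 14) ℤ.+ ℤ.- τ ≡ + 10000 ℤ.* a ℤ.+ 0ℤ ℤ.+ (+ 10 ℤ.- τ ℤ.+ + 139990)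
        middle-identity = ℤR.solve-∀

        -- Column c + 14 is at horizontal distance at least 139990 from both hubs: 14 * S, with 10
        -- left for the offset of its points.
        hubs-apart : ∀ f c m → f ⊨ on (S ℤ.* + c ℤ.+ 0ℤ , h) → f ⊨ on (S ℤ.* + (c ℕ.+ (28 ℕ.+ m)) ℤ.+ 0ℤ , h) →
          f ⊨ outside (S ℤ.* + (c ℕ.+ 14) ℤ.+ ℤ.- tilt (c ℕ.+ 14) , + 1) →
          f ⊨ outside (S ℤ.* + (c ℕ.+ 14) ℤ.+ ℤ.- tilt (c ℕ.+ 14) , + 2 ℤ.* h ℤ.- + 1) → ⊥
        hubs-apart f c m h₁ h₂ h₃ h₄ = midpoint f (S ℤ.* + c ℤ.+ 0ℤ) (+ 10 ℤ.- τ) (+ 10 ℤ.+ + 10000 ℤ.* + m ℤ.+ τ)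
          (subst (0ℤ ℤ.≤_) (shape₁ τ) (0≤n 6 ⊹ small-≤0 (small-tilt (c ℕ.+ 14))))
          (subst (0ℤ ℤ.≤_) (shape₂ τ (+ m)) (0≤n 6 ⊹ 0≤-* (0≤n 10000) (0≤n m) ⊹ small-0≤ (small-tilt (c ℕ.+ 14))))
          h₁ (subst (λ x → f ⊨ on (x , h)) (hub-identity (+ c) (+ m) τ) h₂)
          (subst (λ x → f ⊨ outside (x , + 1)) (middle-identity (+ c) τ) h₃)
          (subst (λ x → f ⊨ outside (x , + 2 ℤ.* h ℤ.- + 1)) (middle-identity (+ c) τ) h₄)
          where
          τ = tilt (c ℕ.+ 14)
          shape₁ : ∀ τ → + 6 ℤ.+ (+ 4 ℤ.- τ) ≡ + 10 ℤ.- τ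
          shape₁ = ℤR.solve-∀
          shape₂ : ∀ τ m → + 6 ℤ.+ + 10000 ℤ.* m ℤ.+ (τ ℤ.+ + 4) ≡ + 10 ℤ.+ + 10000 ℤ.* m ℤ.+ τ
          shape₂ = ℤR.solve-∀

      hub-collision : ∀ a b → toℕ a ℕ.< toℕ b → toℕ b ℕ.< s → δ (hub a) ≢ δ (hub b)
      hub-collision a b a<b b<s eq = hubs-apart (F (δ (hub a))) c (m ℕ.* 28) (on-δ (hub a))
        (subst₂ (λ i c → F i ⊨ on (S ℤ.* + c ℤ.+ 0ℤ , h)) (sym eq) column-b (on-δ (hub b)))
        (off-strut 0F (δ (hub a)) (c ℕ.+ 14) c+14<N) (off-strut 2F (δ (hub a)) (c ℕ.+ 14) c+14<N)
        where
        c = toℕ a ℕ.* spacing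
        m = proj₁ (ℕₚ.m≤n⇒∃[o]m+o≡n a<b)
        column-b : toℕ b ℕ.* spacing ≡ c ℕ.+ (28 ℕ.+ m ℕ.* 28)
        column-b = trans (cong (ℕ._* spacing) (trans (sym (proj₂ (ℕₚ.m≤n⇒∃[o]m+o≡n a<b))) (sym (ℕₚ.+-suc (toℕ a) m))))
                         (ℕₚ.*-distribʳ-+ spacing (toℕ a) (suc m))
        c+14<N : c ℕ.+ 14 ℕ.< N
        c+14<N = ℕₚ.<-≤-trans (ℕₚ.+-monoʳ-< c (toWitness {a? = 14 ℕₚ.<? 28} _))
          (ℕₚ.≤-trans (ℕₚ.≤-reflexive (ℕₚ.+-comm c 28)) (ℕₚ.*-monoˡ-≤ spacing (ℕₚ.≤-trans a<b (ℕₚ.<⇒≤ b<s))))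

      hub-disk : Fin s → Fin k
      hub-disk t = δ (hub (t ↑ˡ e))

      hub-disk-injective : Injective _≡_ _≡_ hub-disk
      hub-disk-injective {t} {t′} eq = compare (ℕₚ.<-cmp (toℕ t) (toℕ t′))
        where
        value : ∀ (t : Fin s) → toℕ (t ↑ˡ e) ≡ toℕ t
        value t = Finₚ.toℕ-↑ˡ t e
        collision : ∀ t t′ → toℕ t ℕ.< toℕ t′ → hub-disk t ≢ hub-disk t′
        collision t t′ t<t′ = hub-collision (t ↑ˡ e) (t′ ↑ˡ e) (subst₂ ℕ._<_ (sym (value t)) (sym (value t′)) t<t′)
          (subst (ℕ._< s) (sym (value t′)) (Finₚ.toℕ<n t′))
        compare : _ → t ≡ t′
        compare (tri< t<t′ _ _) = ⊥-elim (collision t t′ t<t′ eq)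
        compare (tri≈ _ t≡t′ _) = Finₚ.toℕ-injective t≡t′
        compare (tri> _ _ t′<t) = ⊥-elim (collision t′ t t′<t (sym eq))

      -- The three families are disjoint: disks charged to the lower wall touch neither a hub nor
      -- the upper wall, and those charged to the upper wall touch no hub.
      disk-count : interior-rungs ℕ.+ (interior-rungs ℕ.+ s) ℕ.≤ k
      disk-count = sum-≤ {f = Bottom.assign} {g = Ceiling.assign} {o = hub-disk}
        Bottom.assign-injective Ceiling.assign-injective hub-disk-injective
        (λ b c eq → Bottom.assign-outer b (subst (Touches upper) (sym eq) (Ceiling.assign-upper c)))
        (λ b t eq → Bottom.assign-outer b (subst (Touches upper) (sym eq) (δ-touches upper (hub (t ↑ˡ e)) tt)))
        (λ c t eq → Ceiling.assign-outer c (subst (Touches lower) (sym eq) (δ-touches lower (hub (t ↑ˡ e)) tt)))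

-- From covers to the bound on D(n)

open Approximations using (fromℤ-+; fromℤ-*; fromℤ-mono-≤)
open Configurations
open Counting
open D using (IsMinimum; DisjointEmptyCover; PointSet)

-- No decision procedure for `Q` is assumed, so the least number principle is available under double
-- negation.
¬¬-minimum : ∀ (Q : ℕ → Set) {m} → Q m → ¬ ¬ ∃ (IsMinimum Q)
¬¬-minimum Q {m} q none = <-rec (λ m → ¬ Q m) step m q
  where
  step : ∀ m → (∀ {j} → j ℕ.< m → ¬ Q j) → ¬ Q m
  step m smaller q = none (m , q , λ j qj → ℕₚ.≮⇒≥ λ j<m → smaller j<m qj)

-- With s = suc s₀, the count is 2 (28 s - 6) + s = 57 s - 12.
block-bound : ∀ s₀ e {k} → DisjointEmptyCover (Points.points (LowerBound.N s₀ e) (LowerBound.T′ s₀ e)) k →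
  57 ℕ.* suc s₀ ℕ.≤ k ℕ.+ 12
block-bound s₀ e {k} cover = subst (ℕ._≤ k ℕ.+ 12) (count s₀) (ℕₚ.+-monoˡ-≤ 12 (LowerBound.Cover.disk-count s₀ e cover))
  where
  open ℕS.+-*-Solver
  count : ∀ s₀ → 22 ℕ.+ s₀ ℕ.* 28 ℕ.+ (22 ℕ.+ s₀ ℕ.* 28 ℕ.+ suc s₀) ℕ.+ 12 ≡ 57 ℕ.* suc s₀
  count = solve 1 (λ s → con 22 :+ s :* con 28 :+ (con 22 :+ s :* con 28 :+ (con 1 :+ s)) :+ con 12
    := con 57 :* (con 1 :+ s)) refl

-- The conclusion is a decidable inequality, so D(P) may be assumed to exist although this is only
-- known under double negation.
Dmax-≥ : ∀ {n d c m b} (P : PointSet n) → DisjointEmptyCover P m →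
  (∀ {k} → DisjointEmptyCover P k → b ℕ.≤ k ℕ.+ c) → Dmax[ n ]≡ d → b ℕ.≤ d ℕ.+ c
Dmax-≥ {d = d} {c} {b = b} P cover lower max = decidable-stable (b ℕₚ.≤? d ℕ.+ c) λ exceeds →
  ¬¬-minimum (DisjointEmptyCover P) cover λ (k , min) → exceeds
    (ℕₚ.≤-trans (lower (proj₁ min)) (ℕₚ.+-monoˡ-≤ c (proj₂ max k (P , min))))

size-eq : ∀ s₀ r → r ℕ.+ suc s₀ ℕ.* 113 ≡ Configuration.size (LowerBound.N s₀ r) (LowerBound.T′ s₀ r)
size-eq s₀ r = eq (suc s₀) r
  where
  open ℕS.+-*-Solver
  eq : ∀ s r → r ℕ.+ s ℕ.* 113 ≡ s ℕ.* 28 ℕ.* 4 ℕ.+ (s ℕ.+ r)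
  eq = solve 2 (λ s r → r :+ s :* con 113 := s :* con 28 :* con 4 :+ (s :+ r)) refl

Dmax-bound : ∀ q r d → Dmax[ r ℕ.+ q ℕ.* 113 ]≡ d → 57 ℕ.* q ℕ.≤ d ℕ.+ 12
Dmax-bound zero     r d max = z≤n
Dmax-bound (suc s₀) r d max = Dmax-≥ (Points.points (LowerBound.N s₀ r) (LowerBound.T′ s₀ r))
  (TinyCover.tiny-cover (LowerBound.N s₀ r) (LowerBound.T′ s₀ r)) (block-bound s₀ r) (subst (Dmax[_]≡ d) (size-eq s₀ r) max)

fromℕ≡fromℤ : ∀ n → fromℕ n ≡ fromℤ (+ n)
fromℕ≡fromℤ n = ℚₚ.↥p/↧p≡p (fromℤ (+ n))

-- Division by 514, since 259 / 514 = 1 / 2 + 1 / 257 and 51400 / 514 = 100.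
rational-bound : ∀ n d → 259 ℕ.* n ℕ.≤ 514 ℕ.* d ℕ.+ 51400 →
  (½ ℚ.+ + 1 ℚ./ 257) ℚ.* fromℕ n ℚ.- fromℤ (+ 100) ℚ.≤ fromℕ d
rational-bound n d le = subst₂ ℚ._≤_ (left n) (right d)
  (ℚₚ.*-monoˡ-≤-nonNeg (+ 1 ℚ./ 514) (ℚₚ.+-monoˡ-≤ (ℚ.- fromℤ (+ 51400)) cleared))
  where
  open ℚS.+-*-Solver
  cleared : fromℤ (+ 259) ℚ.* fromℤ (+ n) ℚ.≤ fromℤ (+ 514) ℚ.* fromℤ (+ d) ℚ.+ fromℤ (+ 51400)
  cleared = subst₂ ℚ._≤_
    (trans (cong fromℤ (ℤₚ.pos-* 259 n)) (fromℤ-* (+ 259) (+ n)))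
    (trans (fromℤ-+ (+ (514 ℕ.* d)) (+ 51400))
      (cong (ℚ._+ fromℤ (+ 51400)) (trans (cong fromℤ (ℤₚ.pos-* 514 d)) (fromℤ-* (+ 514) (+ d)))))
    (fromℤ-mono-≤ (ℤ.+≤+ le))
  left : ∀ n → + 1 ℚ./ 514 ℚ.* (fromℤ (+ 259) ℚ.* fromℤ (+ n) ℚ.- fromℤ (+ 51400))
    ≡ (½ ℚ.+ + 1 ℚ./ 257) ℚ.* fromℕ n ℚ.- fromℤ (+ 100)
  left n = trans (solve 1 (λ n → con (+ 1 ℚ./ 514) :* (con (fromℤ (+ 259)) :* n :- con (fromℤ (+ 51400)))
      := con (½ ℚ.+ + 1 ℚ./ 257) :* n :- con (fromℤ (+ 100))) refl (fromℤ (+ n)))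
    (cong (λ p → (½ ℚ.+ + 1 ℚ./ 257) ℚ.* p ℚ.- fromℤ (+ 100)) (sym (fromℕ≡fromℤ n)))
  right : ∀ d → + 1 ℚ./ 514 ℚ.* (fromℤ (+ 514) ℚ.* fromℤ (+ d) ℚ.+ fromℤ (+ 51400) ℚ.- fromℤ (+ 51400)) ≡ fromℕ d
  right d = trans (solve 1 (λ d → con (+ 1 ℚ./ 514) :* (con (fromℤ (+ 514)) :* d :+ con (fromℤ (+ 51400))
      :- con (fromℤ (+ 51400)))
      := d) refl (fromℤ (+ d))) (sym (fromℕ≡fromℤ d))

-- The numbers are kept abstract because multiplication by a large literal
-- unfolds during type checking.
linear-≤ : ∀ {α β γ μ R c K} s t {q r d} → α ℕ.* β ℕ.+ s ≡ γ ℕ.* μ → α ℕ.* R ℕ.+ γ ℕ.* c ℕ.+ t ≡ K →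
  r ℕ.≤ R → μ ℕ.* q ℕ.≤ d ℕ.+ c → α ℕ.* (r ℕ.+ q ℕ.* β) ℕ.≤ γ ℕ.* d ℕ.+ K
linear-≤ {α} {β} {γ} {μ} {R} {c} s t {q} {r} {d} eq refl r≤R le = begin
  α ℕ.* (r ℕ.+ q ℕ.* β)                         ≤⟨ ℕₚ.m≤m+n _ (s ℕ.* q) ⟩
  α ℕ.* (r ℕ.+ q ℕ.* β) ℕ.+ s ℕ.* q             ≡⟨ regroup α β r q s ⟩
  α ℕ.* r ℕ.+ (α ℕ.* β ℕ.+ s) ℕ.* q             ≡⟨ cong (λ p → α ℕ.* r ℕ.+ p ℕ.* q) eq ⟩
  α ℕ.* r ℕ.+ γ ℕ.* μ ℕ.* q                     ≡⟨ cong (α ℕ.* r ℕ.+_) (ℕₚ.*-assoc γ μ q) ⟩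
  α ℕ.* r ℕ.+ γ ℕ.* (μ ℕ.* q)                   ≤⟨ ℕₚ.+-mono-≤ (ℕₚ.*-monoʳ-≤ α r≤R) (ℕₚ.*-monoʳ-≤ γ le) ⟩
  α ℕ.* R ℕ.+ γ ℕ.* (d ℕ.+ c)                   ≤⟨ ℕₚ.m≤m+n _ t ⟩
  α ℕ.* R ℕ.+ γ ℕ.* (d ℕ.+ c) ℕ.+ t             ≡⟨ collect (α ℕ.* R) γ d c t ⟩
  γ ℕ.* d ℕ.+ (α ℕ.* R ℕ.+ γ ℕ.* c ℕ.+ t)       ∎
  where
  open ℕₚ.≤-Reasoning
  open ℕS.+-*-Solver
  regroup : ∀ α β r q s → α ℕ.* (r ℕ.+ q ℕ.* β) ℕ.+ s ℕ.* q ≡ α ℕ.* r ℕ.+ (α ℕ.* β ℕ.+ s) ℕ.* q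
  regroup = solve 5 (λ α β r q s → α :* (r :+ q :* β) :+ s :* q := α :* r :+ (α :* β :+ s) :* q) refl
  collect : ∀ p γ d c t → p ℕ.+ γ ℕ.* (d ℕ.+ c) ℕ.+ t ≡ γ ℕ.* d ℕ.+ (p ℕ.+ γ ℕ.* c ℕ.+ t)
  collect = solve 5 (λ p γ d c t → p :+ γ :* (d :+ c) :+ t := γ :* d :+ (p :+ γ :* c :+ t)) refl

open import Data.Rational.Base using (_+_; _-_; _*_; _/_; _≤_)

theorem3 :
    ∃ λ (C : ℚ) →
    ∀ (n : ℕ) → 1 ℕ.≤ n →
    ∀ (d : ℕ) → Dmax[ n ]≡ d →
    (½ + + 1 / 257) * fromℕ n - C ≤ fromℕ d
theorem3 = fromℤ (+ 100) , λ n _ d max → rational-bound n d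
  (subst (λ n → 259 ℕ.* n ℕ.≤ 514 ℕ.* d ℕ.+ 51400) (sym (m≡m%n+[m/n]*n n 113))
    -- The inequality 57 / 113 ≥ 259 / 514 has the surplus 31 = 514 * 57 - 259 * 113, and 16224
    -- fills up 259 * 112 + 514 * 12 to 51400; the remainder of n modulo 113 is at most 112.
    (linear-≤ {259} {113} {514} {57} {112} {12} {51400} 31 16224 {n ℕ./ 113} {n ℕ.% 113} {d}
      refl refl (ℕₚ.≤-pred (m%n<n n 113))
      (Dmax-bound (n ℕ./ 113) (n ℕ.% 113) d (subst (Dmax[_]≡ d) (m≡m%n+[m/n]*n n 113) max))))
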